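{- Let $W$ and $\mu$ be positive integers and let $X,Y$ be finite multisets of integers in $\{1,\dots,W\}$. Put $r=|X|\ge1$, and suppose each value occurs at most $\mu$ times in $X$. If $$r^2\ge512\,\mu W\lceil\log(2r)\rceil,\qquad \Sigma(Y)\ge\frac{256\,\mu W^2}{r},$$ then $\mathcal S(X)\cap\mathcal S(Y)$ contains a positive integer.
   Context: For a finite multiset $X$ of integers, $|X|$ counts occurrences with multiplicity, $\Sigma(X)=\sum_{x\in X}x$, and $\mathcal S(X)=\{\Sigma(Z):Z\subseteq X\}$ is the set of subset sums, where a submultiset $Z$ chooses occurrences without replacement (the empty choice, with sum $0$, is allowed). Logarithms are base two. -}

module Defs where

open import Data.List.Base using (List; length; filter)
open import Data.List.Relation.Binary.Sublist.Propositional using (_⊆_)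
open import Data.Nat.Base using (ℕ)
open import Data.Nat.ListAction using (sum)
open import Data.Nat.Properties using (_≟_)
open import Data.Product.Base using (∃-syntax; _×_)
open import Level using (0ℓ)
open import Relation.Binary.PropositionalEquality.Core using (_≡_)
open import Relation.Unary using (Pred)

-- A finite multiset of natural numbers is represented by a list of its
-- occurrences; the notions below do not depend on the order of the list.
Multiset : Set
Multiset = List ℕ

multiplicity : ℕ → Multiset → ℕ
multiplicity v X = length (filter (v ≟_) X)

-- A choice of occurrences without replacement is a sublist Z ⊆ X
-- (not necessarily contiguous); Z may be empty.
SubsetSums : Multiset → Pred ℕ 0ℓ
SubsetSums X s = ∃[ Z ] (Z ⊆ X × sum Z ≡ s)

{-# OPTIONS --safe #-}
module Submission where

open import Defs
open import Data.Bool.Base using (Bool; true; false; T; not; _∧_; _∨_)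
open import Data.Bool.ListAction using (any)
open import Data.Bool.Properties using (T-∧; T-∨)
open import Data.Empty using (⊥; ⊥-elim)
open import Data.Fin.Base using (toℕ; fromℕ<)
open import Data.Fin.Properties using (pigeonhole; toℕ<n; fromℕ<-injective)
import Data.Integer.Base as ℤ using (_≤_)
import Data.Integer.Properties as ℤ using (drop‿+≤+; pos-*)
open import Data.List.Base using (List; []; _∷_; [_]; _++_; map; length; filter; concatMap; foldr; replicate; take; drop; downFrom)
open import Data.List.Membership.Propositional using (find; lose) renaming (_∈_ to _∈ˡ_)
open import Data.List.Membership.Propositional.Properties using (∈-∃++; ∈-map⁺; ∈-map⁻; ∈-++⁻; ∈-downFrom⁺; ∈-downFrom⁻)
open import Data.List.Properties
  using (filter-accept; filter-reject; filter-++; length-filter; length-++; length-map; length-replicate;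
         length-take; length-drop; take++drop≡id)
open import Data.List.Relation.Binary.Permutation.Propositional as ↭ using (_↭_; ↭-sym; ↭-trans; ↭-reflexive)
open import Data.List.Relation.Binary.Permutation.Propositional.Properties
  using (shift; shifts; filter-↭; ↭-length; map⁺; All-resp-↭; ++⁺ˡ)
open import Data.List.Relation.Binary.Sublist.Propositional using (_⊆_; []; _∷_; _∷ʳ_; minimum; ⊆-refl)
open import Data.List.Relation.Binary.Sublist.Propositional.Properties using (++⁺)
open import Data.List.Relation.Unary.All as All using (All; []; _∷_)
import Data.List.Relation.Unary.All.Properties as All
open import Data.List.Relation.Unary.AllPairs as AllPairs using (AllPairs; []; _∷_)
import Data.List.Relation.Unary.AllPairs.Properties as AllPairs
open import Data.List.Relation.Unary.Any as Any using (here; there)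
open import Data.List.Relation.Unary.Any.Properties using (any⁺; any⁻)
open import Data.Nat.Base hiding (_/_)
open import Data.Nat.DivMod using (m≡m%n+[m/n]*n; m%n<n; [m+n]%n≡m%n; m/n*n≤m; m≥n⇒m/n>0) renaming (_/_ to _/ₙ_)
open import Data.Nat.Divisibility using (_∣_; divides; ∣-trans; ∣m+n∣m⇒∣n; n∣m*n)
open import Data.Nat.GCD using (gcd; gcd-GCD; gcd[m,n]∣m; gcd[m,n]∣n; c*gcd[m,n]≡gcd[cm,cn]; module Bézout)
open import Data.Nat.ListAction using (sum)
open import Data.Nat.ListAction.Properties using (sum-++; sum-↭)
open import Data.Nat.Logarithm using (⌈log₂_⌉; ⌈log₂⌉-mono-≤; ⌈log₂⌈n/2⌉⌉≡⌈log₂n⌉∸1)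
open import Data.Nat.Properties
open import Data.Nat.Tactic.RingSolver using (solve-∀)
open import Data.Product.Base using (∃-syntax; _×_; _,_; proj₁; proj₂)
open import Data.Rational.Unnormalised.Base using (_/_; *≤*) renaming (_≥_ to _≥ℚ_)
open import Data.Sum.Base using (_⊎_; inj₁; inj₂; [_,_]′)
open import Data.Unit.Base using (tt)
open import Function.Base using (_∘_; id)
open import Function.Bundles using (Equivalence)
open import Relation.Binary.PropositionalEquality
  using (_≡_; _≢_; refl; sym; trans; cong; cong₂; subst; subst₂; module ≡-Reasoning)
open import Relation.Nullary using (¬_; yes; no; contradiction)
open import Relation.Unary using (_∈_; _∩_)

-- Split X into two halves.  By dyadic pigeonholing of the number of representations, some
-- set B of b sums x + x′ (one summand from each half) has every member represented at
-- least τ times, where τ b ≥ 18 μ W and b ≥ 5 r / (128 μ).  Let m = max B and d = gcd B.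
-- In the group dℤ/mℤ, an Olson-type bound |A + B| ≥ |A| + b / 2 (proved with Hamidoune's
-- atoms) makes ⌊2 m / (d b)⌋ summands from B reach every residue, and further copies of m
-- then give all sufficiently large multiples of d.  At most 9 W / b elements of B are used,
-- so τ is large enough to realise them greedily by disjoint pairs from X.  Finally, among
-- any d elements of Y some have a sum divisible by d, so the multiples of d in 𝒮(Y) have
-- gaps at most d W, and one of them falls in the range covered by 𝒮(X).

-- The two lower bounds on `b` are dictated by the end of the proof. With `k` summands per residue,
-- the common element is a multiple of `d` in a window from `k m` to `k m + d W`. Since
-- `d b ≤ m ≤ 2 W` and `k ≤ 2 m / (d b)`, `b` times its upper end is at most `10 W²`; comparing with
-- the bound on `Σ(Y)` leaves `b ≥ 5 r / (128 μ)`. A pair removed from `X` spoils at most `2 μ`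
-- representations of any sum, and `2 μ` times `9 W / b` is the demand on `τ`. The logarithm in the
-- density hypothesis pays for the number of dyadic levels. Taking the summands from separate halves
-- prevents a pair from using one occurrence twice. The maximum of `B` is chosen as modulus because
-- it is then zero in the group: iterated sumsets are nested, and padding by it leaves the residue
-- alone. A gain of `b / 2` per step is the right one to expect: if `B` is the union of two cosets
-- of a subgroup `K`, one in `K` itself, then `K + B` exceeds `K` by exactly `b / 2`.

interchange : ∀ a b c d → a + b + (c + d) ≡ a + c + (b + d)
interchange = solve-∀

-- Finite sums, and counting with Boolean predicates

sumTo : (ℕ → ℕ) → ℕ → ℕ
sumTo f zero    = 0
sumTo f (suc n) = sumTo f n + f n

sumTo-mono : ∀ {f g} n → (∀ i → i < n → f i ≤ g i) → sumTo f n ≤ sumTo g n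
sumTo-mono zero    f≤g = z≤n
sumTo-mono (suc n) f≤g =
  +-mono-≤ (sumTo-mono n (λ i i<n → f≤g i (m<n⇒m<1+n i<n))) (f≤g n (n<1+n n))

sumTo-cong : ∀ {f g} n → (∀ i → i < n → f i ≡ g i) → sumTo f n ≡ sumTo g n
sumTo-cong n f≗g = ≤-antisym
  (sumTo-mono n (λ i i<n → ≤-reflexive (f≗g i i<n)))
  (sumTo-mono n (λ i i<n → ≤-reflexive (sym (f≗g i i<n))))

sumTo-+ : ∀ f g n → sumTo (λ i → f i + g i) n ≡ sumTo f n + sumTo g n
sumTo-+ f g zero    = refl
sumTo-+ f g (suc n) =
  trans (cong (_+ (f n + g n)) (sumTo-+ f g n)) (interchange (sumTo f n) (sumTo g n) (f n) (g n))

sumTo-suc : ∀ f n → sumTo f (suc n) ≡ f 0 + sumTo (f ∘ suc) n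
sumTo-suc f zero    = sym (+-identityʳ (f 0))
sumTo-suc f (suc n) = trans (cong (_+ f (suc n)) (sumTo-suc f n)) (+-assoc (f 0) _ _)

sumTo-monoʳ-≤ : ∀ f {m n} → m ≤ n → sumTo f m ≤ sumTo f n
sumTo-monoʳ-≤ f {n = zero}  z≤n = z≤n
sumTo-monoʳ-≤ f {n = suc n} m≤1+n with m≤n⇒m<n∨m≡n m≤1+n
... | inj₁ (s≤s m≤n) = ≤-trans (sumTo-monoʳ-≤ f m≤n) (m≤m+n _ _)
... | inj₂ refl      = ≤-refl

sumTo-reverse : ∀ f n → sumTo (λ i → f (n ∸ i)) (suc n) ≡ sumTo f (suc n)
sumTo-reverse f zero    = refl
sumTo-reverse f (suc n) = begin
  sumTo (λ i → f (suc n ∸ i)) (suc (suc n))   ≡⟨ sumTo-suc (λ i → f (suc n ∸ i)) (suc n) ⟩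
  f (suc n) + sumTo (λ i → f (n ∸ i)) (suc n) ≡⟨ cong (f (suc n) +_) (sumTo-reverse f n) ⟩
  f (suc n) + sumTo f (suc n)                 ≡⟨ +-comm (f (suc n)) _ ⟩
  sumTo f (suc (suc n))                       ∎
  where open ≡-Reasoning

∃-sumTo-< : ∀ f g n → sumTo f n < sumTo g n → ∃[ i ] (i < n × f i < g i)
∃-sumTo-< f g (suc n) Σf<Σg with f n <? g n
... | yes fn<gn = n , n<1+n n , fn<gn
... | no  fn≮gn with ∃-sumTo-< f g n (+-cancelʳ-< (g n) _ _ (≤-<-trans (+-monoʳ-≤ _ (≮⇒≥ fn≮gn)) Σf<Σg))
... | i , i<n , fi<gi = i , m<n⇒m<1+n i<n , fi<gi

indicator : Bool → ℕ
indicator true  = 1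
indicator false = 0

indicator-mono : ∀ {a b} → (T a → T b) → indicator a ≤ indicator b
indicator-mono {false}         a⇒b = z≤n
indicator-mono {true}  {true}  a⇒b = s≤s z≤n
indicator-mono {true}  {false} a⇒b = ⊥-elim (a⇒b tt)

count : (ℕ → Bool) → ℕ → ℕ
count A = sumTo (indicator ∘ A)

count-mono : ∀ {A B} n → (∀ i → i < n → T (A i) → T (B i)) → count A n ≤ count B n
count-mono n A⇒B = sumTo-mono n (λ i i<n → indicator-mono (A⇒B i i<n))

count-∨-∧ : ∀ A B n → count (λ i → A i ∨ B i) n + count (λ i → A i ∧ B i) n ≡ count A n + count B n
count-∨-∧ A B n = begin
  count (λ i → A i ∨ B i) n + count (λ i → A i ∧ B i) n
    ≡⟨ sumTo-+ _ _ n ⟨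
  sumTo (λ i → indicator (A i ∨ B i) + indicator (A i ∧ B i)) n
    ≡⟨ sumTo-cong n (λ i _ → pointwise (A i) (B i)) ⟩
  sumTo (λ i → indicator (A i) + indicator (B i)) n
    ≡⟨ sumTo-+ _ _ n ⟩
  count A n + count B n ∎
  where
  open ≡-Reasoning
  pointwise : ∀ a b → indicator (a ∨ b) + indicator (a ∧ b) ≡ indicator a + indicator b
  pointwise false b     = +-identityʳ _
  pointwise true  false = refl
  pointwise true  true  = refl

count-not : ∀ A n → count (not ∘ A) n + count A n ≡ n
count-not A zero    = refl
count-not A (suc n) = begin
  count (not ∘ A) n + indicator (not (A n)) + (count A n + indicator (A n))
    ≡⟨ interchange (count (not ∘ A) n) (indicator (not (A n))) (count A n) (indicator (A n)) ⟩
  count (not ∘ A) n + count A n + (indicator (not (A n)) + indicator (A n))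
    ≡⟨ cong₂ _+_ (count-not A n) (pointwise (A n)) ⟩
  n + 1
    ≡⟨ +-comm n 1 ⟩
  suc n ∎
  where
  open ≡-Reasoning
  pointwise : ∀ a → indicator (not a) + indicator a ≡ 1
  pointwise false = refl
  pointwise true  = refl

count-≤ : ∀ A n → count A n ≤ n
count-≤ A n = ≤-trans (m≤n+m _ _) (≤-reflexive (count-not A n))

count-all : ∀ A n → (∀ i → T (A i)) → n ≤ count A n
count-all A zero    all = z≤n
count-all A (suc n) all with A n in eq
... | true  = ≤-trans (≤-reflexive (+-comm 1 n)) (+-monoˡ-≤ 1 (count-all A n all))
... | false = ⊥-elim (subst T eq (all n))

count-⊆⇒⊇ : ∀ {A B} n → (∀ i → i < n → T (A i) → T (B i)) → count B n ≤ count A n →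
            ∀ i → i < n → T (B i) → T (A i)
count-⊆⇒⊇ {A} {B} (suc n) A⇒B ∣B∣≤∣A∣ i (s≤s i≤n) Bi with m≤n⇒m<n∨m≡n i≤n
... | inj₁ i<n = count-⊆⇒⊇ n (λ j j<n → A⇒B j (m<n⇒m<1+n j<n))
                   (+-cancelʳ-≤ (indicator (A n)) _ _
                     (≤-trans (+-monoʳ-≤ (count B n) (indicator-mono (A⇒B n (n<1+n n)))) ∣B∣≤∣A∣))
                   i i<n Bi
... | inj₂ refl = last (A n) (B n) Bi
      (+-cancelˡ-≤ (count B n) _ _
        (≤-trans ∣B∣≤∣A∣ (+-monoˡ-≤ _ (count-mono n (λ j j<n → A⇒B j (m<n⇒m<1+n j<n))))))
  where
  last : ∀ a b → T b → indicator b ≤ indicator a → T a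
  last true  true _ _ = tt
  last false true _ ()

count-positive⇒∃ : ∀ A n → 1 ≤ count A n → ∃[ i ] (i < n × T (A i))
count-positive⇒∃ A n 1≤∣A∣ with ∃-sumTo-< (λ _ → 0) _ n (≤-trans (s≤s (zeros n)) 1≤∣A∣)
  where
  zeros : ∀ n → sumTo (λ _ → 0) n ≤ 0
  zeros zero    = z≤n
  zeros (suc n) = ≤-trans (≤-reflexive (+-identityʳ _)) (zeros n)
... | i , i<n , p with A i in eq
... | true  = i , i<n , subst T (sym eq) tt

count-∋ : ∀ A n i → i < n → T (A i) → 1 ≤ count A n
count-∋ A (suc n) i (s≤s i≤n) Ai with m≤n⇒m<n∨m≡n i≤n
... | inj₁ i<n = ≤-trans (count-∋ A n i i<n Ai) (m≤m+n _ _)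
... | inj₂ refl with A n
...   | true = m≤n+m 1 _

-- The shift to `A ∘ suc` suits residues represented by 1, ..., n, where the modulus itself stands
-- for 0. In a descending list the head `suc k` confines the tail to 1, ..., `k`, which drives the
-- induction.
length≤count : ∀ A {xs} n → AllPairs _>_ xs → All (λ x → 1 ≤ x × x ≤ n) xs → All (T ∘ A) xs →
               length xs ≤ count (A ∘ suc) n
length≤count A {[]} n _ _ _ = z≤n
length≤count A {suc k ∷ xs} n (x>xs ∷ xs↓) ((_ , x≤n) ∷ bounds) (Ax ∷ Axs) = begin
  suc (length xs)                            ≡⟨ +-comm 1 _ ⟩
  length xs + 1                              ≤⟨ +-mono-≤ (length≤count A k xs↓ bounds′ Axs) (one (A (suc k)) Ax) ⟩
  count (A ∘ suc) k + indicator (A (suc k))  ≤⟨ sumTo-monoʳ-≤ _ x≤n ⟩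
  count (A ∘ suc) n                          ∎
  where
  open ≤-Reasoning
  bounds′ = All.zipWith (λ where ((1≤y , _) , y<x) → 1≤y , ≤-pred y<x) (bounds , x>xs)
  one : ∀ a → T a → 1 ≤ indicator a
  one true _ = ≤-refl

-- A minimiser over Boolean predicates on ℕ is not found by search, so only its double negation is
-- asserted. This is enough wherever the goal is a contradiction.
¬¬-minimum : ∀ {X : Set} (P : X → Set) (f : X → ℕ) → ∃[ x ] P x →
             ¬ ¬ (∃[ x ] (P x × (∀ y → P y → f x ≤ f y)))
¬¬-minimum {X} P f (x , Px) none = descend (suc (f x)) x (n<1+n _) Px
  where
  descend : ∀ n x → f x < n → P x → ⊥
  descend (suc n) x (s≤s fx≤n) Px =
    none (x , Px , λ y Py → ≮⇒≥ (λ fy<fx → descend n y (<-≤-trans fy<fx fx≤n) Py))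

∧-intro : ∀ {a b} → T a → T b → T (a ∧ b)
∧-intro p q = Equivalence.from T-∧ (p , q)

∧-elim : ∀ {a b} → T (a ∧ b) → T a × T b
∧-elim = Equivalence.to T-∧

∨-elim : ∀ {a b} → T (a ∨ b) → T a ⊎ T b
∨-elim = Equivalence.to T-∨

not-intro : ∀ {a} → ¬ T a → T (not a)
not-intro {true}  ¬a = ¬a tt
not-intro {false} ¬a = tt

not-elim : ∀ {a} → T (not a) → ¬ T a
not-elim {false} _ ()

gcds : List ℕ → ℕ
gcds = foldr gcd 0

sum-≤-length* : ∀ {W X} → All (_≤ W) X → sum X ≤ length X * W
sum-≤-length* []            = z≤n
sum-≤-length* (x≤W ∷ X≤W) = +-mono-≤ x≤W (sum-≤-length* X≤W)

-- Difference sets and atoms in ℤ/m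

-- Subsets of ℤ/m, for m = suc p, are encoded as m-periodic predicates on ℕ.
module Cyclic (p : ℕ) (B : List ℕ) where

  m : ℕ
  m = suc p

  Periodic : (ℕ → Bool) → Set
  Periodic A = ∀ i → A (i + m) ≡ A i

  translate : ℕ → (ℕ → Bool) → ℕ → Bool
  translate x A i = A (i + x)

  -- The difference set A − B.
  N : (ℕ → Bool) → ℕ → Bool
  N A i = any (λ b → A (i + b)) B

  N-intro : ∀ A {i b} → b ∈ˡ B → T (A (i + b)) → T (N A i)
  N-intro A {i} b∈B Aib = any⁺ (λ b → A (i + b)) (lose b∈B Aib)

  N-elim : ∀ A {i} → T (N A i) → ∃[ b ] (b ∈ˡ B × T (A (i + b)))
  N-elim A {i} NAi = find (any⁻ (λ b → A (i + b)) B NAi)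

  N-mono : ∀ A A′ → (∀ i → T (A i) → T (A′ i)) → ∀ i → T (N A i) → T (N A′ i)
  N-mono A A′ A⇒A′ i NAi with N-elim A NAi
  ... | b , b∈B , Aib = N-intro A′ b∈B (A⇒A′ _ Aib)

  module _ {A : ℕ → Bool} (per : Periodic A) where

    periodic-* : ∀ i k → A (i + k * m) ≡ A i
    periodic-* i zero    = cong A (+-identityʳ i)
    periodic-* i (suc k) = trans (cong A (rearrange i m (k * m)))
                                 (trans (per (i + k * m)) (periodic-* i k))
      where
      rearrange : ∀ i a b → i + (a + b) ≡ i + b + a
      rearrange = solve-∀

    translate-periodic : ∀ x → Periodic (translate x A)
    translate-periodic x i = trans (cong A (rearrange i m x)) (per (i + x))
      where
      rearrange : ∀ i a b → i + a + b ≡ i + b + a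
      rearrange = solve-∀

    N-periodic : Periodic (N A)
    N-periodic i = go B
      where
      go : ∀ bs → any (λ b → A (i + m + b)) bs ≡ any (λ b → A (i + b)) bs
      go []       = refl
      go (b ∷ bs) = cong₂ _∨_ (translate-periodic b i) (go bs)

    reduce : ∀ i → T (A i) → T (A (i % m))
    reduce i Ai = subst T (trans (cong A (m≡m%n+[m/n]*n i m)) (periodic-* (i % m) (i /ₙ m))) Ai

    expand : ∀ i → T (A (i % m)) → T (A i)
    expand i A[i%m] = subst T (sym (trans (cong A (m≡m%n+[m/n]*n i m)) (periodic-* (i % m) (i /ₙ m)))) A[i%m]

    inhabited⇒count≥1 : ∀ i → T (A i) → 1 ≤ count A m
    inhabited⇒count≥1 i Ai = count-∋ A m (i % m) (m%n<n i m) (reduce i Ai)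

    count-full : m ≤ count A m → ∀ i → T (A i)
    count-full m≤∣A∣ i = expand i (count-⊆⇒⊇ {A} {λ _ → true} m (λ _ _ _ → tt)
                         (≤-trans (count-≤ (λ _ → true) m) m≤∣A∣) (i % m) (m%n<n i m) tt)

  count-translate : ∀ {A} → Periodic A → ∀ x → count (translate x A) m ≡ count A m
  count-translate {A} per zero    = sumTo-cong m (λ i _ → cong (indicator ∘ A) (+-identityʳ i))
  count-translate {A} per (suc x) = begin
    count (translate (suc x) A) m         ≡⟨ sumTo-cong m (λ i _ → cong (indicator ∘ A) (+-suc i x)) ⟩
    count (translate x A ∘ suc) m         ≡⟨ rotate (translate-periodic per x) ⟩
    count (translate x A) m               ≡⟨ count-translate per x ⟩
    count A m                         ∎
    where
    open ≡-Reasoning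
    rotate : ∀ {A} → Periodic A → count (A ∘ suc) m ≡ count A m
    rotate {A} per = +-cancelˡ-≡ (indicator (A 0)) _ _ (begin
      indicator (A 0) + count (A ∘ suc) m  ≡⟨ sumTo-suc (indicator ∘ A) m ⟨
      count A m + indicator (A m)          ≡⟨ cong (λ a → count A m + indicator a) (per 0) ⟩
      count A m + indicator (A 0)          ≡⟨ +-comm (count A m) _ ⟩
      indicator (A 0) + count A m          ∎)

  -- Multiplication by p = m − 1 is negation modulo m.
  negate-periodic : ∀ {A} → Periodic A → Periodic (λ i → A (p * i))
  negate-periodic {A} per i = trans (cong A (*-distribˡ-+ p i m)) (periodic-* per (p * i) p)

  -- Modulo `m`, `−(i + 1)` is `p ∸ i`. After a translation by 1, negation is therefore the reversal
  -- of the range 0, ..., `p`.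
  count-negate : ∀ {A} → Periodic A → count (λ i → A (p * i)) m ≡ count A m
  count-negate {A} per = begin
    count (λ i → A (p * i)) m            ≡⟨ count-translate (negate-periodic per) 1 ⟨
    count (λ i → A (p * (i + 1))) m      ≡⟨ sumTo-cong m (λ i i<m → cong indicator (reflect i (≤-pred i<m))) ⟩
    sumTo (λ i → indicator (A (p ∸ i))) m ≡⟨ sumTo-reverse (indicator ∘ A) p ⟩
    count A m                            ∎
    where
    open ≡-Reasoning
    identity : ∀ q i → (q + i) * (i + 1) ≡ q + i * suc (q + i)
    identity = solve-∀
    reflect : ∀ i → i ≤ p → A (p * (i + 1)) ≡ A (p ∸ i)
    reflect i i≤p = trans
      (cong A (subst (λ z → z * (i + 1) ≡ p ∸ i + i * suc z) (m∸n+n≡m i≤p) (identity (p ∸ i) i)))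
      (periodic-* per (p ∸ i) i)

  -- The field `proper` keeps out sets that already reach everything: for the whole group
  -- `|A − B| − |A|` is 0, and minimising it would say nothing.
  record Candidate (A : ℕ → Bool) : Set where
    field
      periodic : Periodic A
      nonempty : 1 ≤ count A m
      proper   : count (N A) m < m
  open Candidate

  -- The negative of the complement of A − B.
  dual : (ℕ → Bool) → ℕ → Bool
  dual A i = not (N A (p * i))

  dual-periodic : ∀ {A} → Periodic A → Periodic (dual A)
  dual-periodic per i = cong not (negate-periodic (N-periodic per) i)

  count-dual : ∀ {A} → Periodic A → count (dual A) m + count (N A) m ≡ m
  count-dual {A} per = trans (cong (count (dual A) m +_) (sym (count-negate (N-periodic per))))
                             (count-not (λ i → N A (p * i)) m)

  -- If `i + b` is in the dual, then `−i − b` is not in `A − B`, so `−i` is not in `A`. The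
  -- difference set of the dual thus avoids `−A`.
  count-N-dual : ∀ {A} → Periodic A → count (N (dual A)) m + count A m ≤ m
  count-N-dual {A} per = begin
    count (N (dual A)) m + count A m                                   ≡⟨ cong (count (N (dual A)) m +_) (count-negate per) ⟨
    count (N (dual A)) m + count (λ i → A (p * i)) m                   ≤⟨ +-monoˡ-≤ _ (count-mono m (λ i _ → disjoint i)) ⟩
    count (λ i → not (A (p * i))) m + count (λ i → A (p * i)) m        ≡⟨ count-not (λ i → A (p * i)) m ⟩
    m                                                                  ∎
    where
    open ≤-Reasoning
    cancel : ∀ p i b → p * (i + b) + b ≡ p * i + b * suc p
    cancel = solve-∀
    disjoint : ∀ i → T (N (dual A) i) → T (not (A (p * i)))
    disjoint i NDi with N-elim (dual A) NDi
    ... | b , b∈B , Dib = not-intro (λ Api → not-elim Dib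
      (N-intro A b∈B (subst T (sym (trans (cong A (cancel p i b)) (periodic-* per (p * i) b))) Api)))

  -- κ is the least value of |A − B| − |A| over all candidates, and A is a smallest set attaining it.
  record Atom (κ : ℕ) (A : ℕ → Bool) : Set where
    field
      candidate : Candidate A
      ∣NA∣≤     : count (N A) m ≤ κ + count A m
      minimal-κ : ∀ A′ → Candidate A′ → κ + count A′ m ≤ count (N A′) m
      minimal   : ∀ A′ → Candidate A′ → count (N A′) m ≤ κ + count A′ m → count A m ≤ count A′ m

  module _ {κ A} (atom : Atom κ A) where
    open Atom atom

    private
      per = periodic candidate
      a = count A m
      n = count (N A) m

    -- The dual has `m − |A − B|` elements and its difference set at most `m − |A|`, so it attains
    -- `κ` as well. An atom, being smallest, is no larger than its dual.
    ∣A∣+∣NA∣≤m : a + n ≤ m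
    ∣A∣+∣NA∣≤m = ≤-trans (+-monoˡ-≤ n (minimal (dual A) dual-candidate dual-κ)) (≤-reflexive (count-dual per))
      where
      dual-candidate : Candidate (dual A)
      dual-candidate = record
        { periodic = dual-periodic per
        ; nonempty = +-cancelʳ-≤ n _ _ (≤-trans (proper candidate) (≤-reflexive (sym (count-dual per))))
        ; proper   = ≤-trans (≤-trans (≤-reflexive (+-comm 1 _)) (+-monoʳ-≤ _ (nonempty candidate)))
                             (count-N-dual per)
        }
      dual-κ : count (N (dual A)) m ≤ κ + count (dual A) m
      dual-κ = +-cancelʳ-≤ n _ _ (begin
        count (N (dual A)) m + n            ≤⟨ +-monoʳ-≤ (count (N (dual A)) m) ∣NA∣≤ ⟩
        count (N (dual A)) m + (κ + a)      ≡⟨ rearrange (count (N (dual A)) m) κ a ⟩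
        κ + (count (N (dual A)) m + a)      ≤⟨ +-monoʳ-≤ κ (count-N-dual per) ⟩
        κ + m                               ≡⟨ cong (κ +_) (count-dual per) ⟨
        κ + (count (dual A) m + n)          ≡⟨ +-assoc κ _ n ⟨
        κ + count (dual A) m + n            ∎)
        where
        open ≤-Reasoning
        rearrange : ∀ x y z → x + (y + z) ≡ y + (x + z)
        rearrange = solve-∀

    -- Distinct translates of an atom are disjoint: by submodularity of A ↦ |A − B| the intersection D
    -- would attain κ too, unless the union has U − B = ℤ/m, which is too large by ∣A∣+∣NA∣≤m.
    atom-translate : ∀ x i₀ → T (A i₀) → T (A (i₀ + x)) → ∀ i → T (A i) → T (A (i + x))
    atom-translate x i₀ Ai₀ Ai₀+x i Ai =
      proj₂ (∧-elim {A i} (expand D-per i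
        (count-⊆⇒⊇ m (λ j _ → proj₁ ∘ ∧-elim {A j}) a≤∣D∣ (i % m) (m%n<n i m) (reduce per i Ai))))
      where
      A′ D U : ℕ → Bool
      A′ = translate x A
      D i = A i ∧ A′ i
      U i = A i ∨ A′ i

      per′ = translate-periodic per x

      D-per : Periodic D
      D-per i = cong₂ _∧_ (per i) (per′ i)

      U-per : Periodic U
      U-per i = cong₂ _∨_ (per i) (per′ i)

      ∣D∣≥1 : 1 ≤ count D m
      ∣D∣≥1 = inhabited⇒count≥1 D-per i₀ (∧-intro Ai₀ Ai₀+x)

      ND≤n : count (N D) m ≤ n
      ND≤n = count-mono m (λ i _ → N-mono D A (λ j → proj₁ ∘ ∧-elim {A j}) i)

      D-candidate : Candidate D
      D-candidate = record { periodic = D-per ; nonempty = ∣D∣≥1 ; proper = ≤-<-trans ND≤n (proper candidate) }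

      ∣U∣+∣D∣ : count U m + count D m ≡ a + a
      ∣U∣+∣D∣ = trans (count-∨-∧ A A′ m) (cong (a +_) (count-translate per x))

      NA′≗ : ∀ i → N A′ i ≡ translate x (N A) i
      NA′≗ i = go B
        where
        swap : ∀ i b x → i + b + x ≡ i + x + b
        swap = solve-∀
        go : ∀ bs → any (λ b → A′ (i + b)) bs ≡ any (λ b → A (i + x + b)) bs
        go []       = refl
        go (b ∷ bs) = cong₂ _∨_ (cong A (swap i b x)) (go bs)

      ∣NU∣+∣ND∣ : count (N U) m + count (N D) m ≤ n + n
      ∣NU∣+∣ND∣ = begin
        count (N U) m + count (N D) m ≤⟨ +-mono-≤ (count-mono m NU⊆) (count-mono m ND⊆) ⟩
        count (λ i → N A i ∨ N A′ i) m + count (λ i → N A i ∧ N A′ i) m ≡⟨ count-∨-∧ (N A) (N A′) m ⟩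
        n + count (N A′) m            ≡⟨ cong (n +_) (sumTo-cong m (λ i _ → cong indicator (NA′≗ i))) ⟩
        n + count (translate x (N A)) m   ≡⟨ cong (n +_) (count-translate (N-periodic per) x) ⟩
        n + n                         ∎
        where
        open ≤-Reasoning
        NU⊆ : ∀ i → i < m → T (N U i) → T (N A i ∨ N A′ i)
        NU⊆ i _ NUi with N-elim U NUi
        ... | b , b∈B , Uib with ∨-elim {A (i + b)} Uib
        ...   | inj₁ Aib  = Equivalence.from T-∨ (inj₁ (N-intro A b∈B Aib))
        ...   | inj₂ A′ib = Equivalence.from T-∨ (inj₂ (N-intro A′ b∈B A′ib))
        ND⊆ : ∀ i → i < m → T (N D i) → T (N A i ∧ N A′ i)
        ND⊆ i _ NDi = ∧-intro (N-mono D A (λ j → proj₁ ∘ ∧-elim {A j}) i NDi)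
                              (N-mono D A′ (λ j → proj₂ ∘ ∧-elim {A j}) i NDi)

      a≤∣D∣ : a ≤ count D m
      a≤∣D∣ with count (N D) m ≤? κ + count D m
      ... | yes ≤κ = minimal D D-candidate ≤κ
      ... | no  ≰κ with count (N U) m <? m
      ...   | yes NU<m = contradiction ∣NU∣+∣ND∣ (<⇒≱ (begin-strict
              n + n                                   ≤⟨ +-mono-≤ ∣NA∣≤ ∣NA∣≤ ⟩
              (κ + a) + (κ + a)                       ≡⟨ interchange κ a κ a ⟩
              (κ + κ) + (a + a)                       ≡⟨ cong (κ + κ +_) ∣U∣+∣D∣ ⟨
              (κ + κ) + (count U m + count D m)       ≡⟨ interchange κ κ (count U m) (count D m) ⟩
              (κ + count U m) + (κ + count D m)       <⟨ +-mono-≤-< (minimal-κ U U-candidate) (≰⇒> ≰κ) ⟩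
              count (N U) m + count (N D) m           ∎))
        where
        open ≤-Reasoning
        U-candidate : Candidate U
        U-candidate = record { periodic = U-per
          ; nonempty = inhabited⇒count≥1 U-per i₀ (Equivalence.from T-∨ (inj₁ Ai₀)) ; proper = NU<m }
      ...   | no  NU≮m = contradiction ∣NU∣+∣ND∣ (<⇒≱ (begin-strict
              n + n                             ≤⟨ +-monoˡ-≤ n ∣NA∣≤ ⟩
              κ + a + n                         ≡⟨ +-assoc κ a n ⟩
              κ + (a + n)                       ≤⟨ +-monoʳ-≤ κ (≤-trans ∣A∣+∣NA∣≤m (≮⇒≥ NU≮m)) ⟩
              κ + count (N U) m                 ≡⟨ +-comm κ _ ⟩
              count (N U) m + κ                 <⟨ +-monoʳ-< _ (≤-<-trans (m≤m+n κ _) (≰⇒> ≰κ)) ⟩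
              count (N U) m + count (N D) m     ∎))
        where open ≤-Reasoning

  -- Periods of a set, and the subgroup they generate

  Invariant : (ℕ → Bool) → ℕ → Set
  Invariant A x = ∀ i → T (A i) → T (A (i + x))

  module _ {A} (per : Periodic A) where

    invariant-+ : ∀ {x y} → Invariant A x → Invariant A y → Invariant A (x + y)
    invariant-+ {x} {y} inv-x inv-y i Ai = subst (T ∘ A) (+-assoc i x y) (inv-y (i + x) (inv-x i Ai))

    invariant-* : ∀ k {x} → Invariant A x → Invariant A (k * x)
    invariant-* zero    inv i Ai = subst (T ∘ A) (sym (+-identityʳ i)) Ai
    invariant-* (suc k) inv      = invariant-+ inv (invariant-* k inv)

    -- p * u cancels u modulo m.
    invariant-∸ : ∀ {d u v} → d + u ≡ v → Invariant A u → Invariant A v → Invariant A d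
    invariant-∸ {d} {u} refl inv-u inv-v i Ai =
      subst T (trans (cong A (cancel i d u p)) (periodic-* per (i + d) u))
        (invariant-+ inv-v (invariant-* p inv-u) i Ai)
      where
      cancel : ∀ i d u p → i + (d + u + p * u) ≡ i + d + u * suc p
      cancel = solve-∀

    invariant-gcd : ∀ {x y} → Invariant A x → Invariant A y → Invariant A (gcd x y)
    invariant-gcd {x} {y} inv-x inv-y with Bézout.identity (gcd-GCD x y)
    ... | Bézout.+- u v eq = invariant-∸ eq (invariant-* v inv-y) (invariant-* u inv-x)
    ... | Bézout.-+ u v eq = invariant-∸ eq (invariant-* u inv-x) (invariant-* v inv-y)

    invariant-gcds : ∀ {xs} → All (Invariant A) xs → Invariant A (gcds xs)
    invariant-gcds []           = invariant-* 0 {0} (λ i → subst (T ∘ A) (sym (+-identityʳ i)))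
    invariant-gcds (inv ∷ invs) = invariant-gcd inv (invariant-gcds invs)

    invariant-1⇒full : Invariant A 1 → ∀ i₀ → T (A i₀) → ∀ i → T (A i)
    invariant-1⇒full inv i₀ Ai₀ i =
      subst T (trans (cong A (cancel i₀ p i)) (periodic-* per i i₀)) (invariant-* (p * i₀ + i) inv i₀ Ai₀)
      where
      cancel : ∀ i₀ p i → i₀ + (p * i₀ + i) * 1 ≡ i + i₀ * suc p
      cancel = solve-∀

  module _ (B↓ : AllPairs _>_ B) (bounds : All (λ b → 1 ≤ b × b ≤ m) B)
           (m∈B : m ∈ˡ B) (gcd≡1 : gcds B ≡ 1) where

    ⊆N : ∀ {A} → Periodic A → ∀ i → T (A i) → T (N A i)
    ⊆N {A} per i Ai = N-intro A m∈B (subst T (sym (per i)) Ai)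

    -- For one fixed `i` in `A` the residues `i − b`, written `m ∸ b + i`, all lie in `A − B`; they
    -- are distinct because `B` descends strictly within 1, ..., `m`.
    ∣B∣≤∣NA∣ : ∀ {A} → Periodic A → 1 ≤ count A m → length B ≤ count (N A) m
    ∣B∣≤∣NA∣ {A} per 1≤a with count-positive⇒∃ A m 1≤a
    ... | i , _ , Ai = begin
      length B                                        ≤⟨ length≤count (λ b → N A (m ∸ b + i)) m B↓ bounds
                                                           (All.tabulate translates) ⟩
      sumTo (λ j → indicator (N A (p ∸ j + i))) m     ≡⟨ sumTo-reverse (λ j → indicator (N A (j + i))) p ⟩
      count (translate i (N A)) m                         ≡⟨ count-translate (N-periodic per) i ⟩
      count (N A) m                                   ∎
      where
      open ≤-Reasoning
      rearrange : ∀ c i b → c + i + b ≡ i + (c + b)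
      rearrange = solve-∀
      translates : ∀ {b} → b ∈ˡ B → T (N A (m ∸ b + i))
      translates {b} b∈B = N-intro A b∈B (subst T (sym (trans
        (cong A (trans (rearrange (m ∸ b) i b) (cong (i +_) (m∸n+n≡m (proj₂ (All.lookup bounds b∈B))))))
        (per i))) Ai)

    -- The atom is a coset of its stabiliser K, and K ≠ ℤ/m because B generates ℤ/m.
    -- So A − B contains at least two cosets of K.
    atom-doubling : ∀ {κ A} → Atom κ A → count A m + count A m ≤ count (N A) m
    atom-doubling {κ} {A} atom with Any.any? (λ b → count (λ i → A i ∧ A (i + b)) m ≟ 0) B
    ... | yes disjoint with find disjoint
    ...   | b , b∈B , ∣∩∣≡0 = begin
      count A m + count A m            ≡⟨ cong (count A m +_) (count-translate per b) ⟨
      count A m + count (translate b A) m  ≡⟨ count-∨-∧ A (translate b A) m ⟨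
      u + count (λ i → A i ∧ A (i + b)) m ≡⟨ cong (u +_) ∣∩∣≡0 ⟩
      u + 0                            ≡⟨ +-identityʳ u ⟩
      count (λ i → A i ∨ A (i + b)) m  ≤⟨ count-mono m (λ i _ → [ ⊆N per i , N-intro A b∈B ]′ ∘ ∨-elim {A i}) ⟩
      count (N A) m                    ∎
      where
      open ≤-Reasoning
      open Atom atom
      per = periodic candidate
      u = count (λ i → A i ∨ A (i + b)) m
    atom-doubling {κ} {A} atom | no meets =
      contradiction (proper candidate) (≤⇒≯ (count-all (N A) m (λ i → ⊆N per i (full i))))
      where
      open Atom atom
      per = periodic candidate
      inhabited = count-positive⇒∃ A m (nonempty candidate)
      stable : ∀ {b} → b ∈ˡ B → Invariant A b
      stable {b} b∈B with count-positive⇒∃ (λ i → A i ∧ A (i + b)) m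
                            (n≢0⇒n>0 (λ ∣∩∣≡0 → meets (lose b∈B ∣∩∣≡0)))
      ... | i , _ , AiAib = let Ai , Aib = ∧-elim {A i} AiAib in atom-translate atom b i Ai Aib
      full : ∀ i → T (A i)
      full = invariant-1⇒full per (subst (Invariant A) gcd≡1 (invariant-gcds per (All.tabulate stable)))
               (proj₁ inhabited) (proj₂ (proj₂ inhabited))

    -- If the bound fails, the least deficiency satisfies `2 κ < |B|`. An atom `A₂` then gives `2
    -- |A₂ − B| ≤ 2 κ + 2 |A₂| < |B| + |A₂ − B| ≤ 2 |A₂ −
    -- B|`, by doubling and `∣B∣≤∣NA∣`. The inequality is decidable, so `¬¬-minimum` may be used for
    -- it.
    growth : ∀ {A} → Candidate A → 2 * count A m + length B ≤ 2 * count (N A) m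
    growth {A} cand with 2 * count A m + length B ≤? 2 * count (N A) m
    ... | yes grows = grows
    ... | no  ¬grows = ⊥-elim (¬¬-minimum Candidate deficiency (A , cand) step)
      where
      -- Truncated subtraction loses nothing here: `m` is in `B`, so `A` lies inside `A − B`.
      deficiency : (ℕ → Bool) → ℕ
      deficiency A = count (N A) m ∸ count A m
      a≤n : ∀ {A} → Candidate A → count A m ≤ count (N A) m
      a≤n c = count-mono m (λ i _ → ⊆N (periodic c) i)
      step : ¬ (∃[ A₁ ] (Candidate A₁ × (∀ A′ → Candidate A′ → deficiency A₁ ≤ deficiency A′)))
      step (A₁ , cand₁ , least) = ¬¬-minimum
        (λ A′ → Candidate A′ × count (N A′) m ≤ κ + count A′ m) (λ A′ → count A′ m)
        (A₁ , cand₁ , ≤-reflexive (sym (m∸n+n≡m (a≤n cand₁)))) finish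
        where
        κ = deficiency A₁
        minimal-κ′ : ∀ A′ → Candidate A′ → κ + count A′ m ≤ count (N A′) m
        minimal-κ′ A′ c′ = ≤-trans (+-monoˡ-≤ _ (least A′ c′)) (≤-reflexive (m∸n+n≡m (a≤n c′)))
        2κ<∣B∣ : κ + κ < length B
        2κ<∣B∣ = +-cancelˡ-< (2 * count A m) _ _ (begin-strict
          2 * count A m + (κ + κ)  ≡⟨ rearrange (count A m) κ ⟩
          2 * (κ + count A m)      ≤⟨ *-monoʳ-≤ 2 (minimal-κ′ A cand) ⟩
          2 * count (N A) m        <⟨ ≰⇒> ¬grows ⟩
          2 * count A m + length B ∎)
          where
          open ≤-Reasoning
          rearrange : ∀ a k → 2 * a + (k + k) ≡ 2 * (k + a)
          rearrange = solve-∀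
        finish : ¬ (∃[ A₂ ] ((Candidate A₂ × count (N A₂) m ≤ κ + count A₂ m) ×
                   (∀ A′ → Candidate A′ × count (N A′) m ≤ κ + count A′ m → count A₂ m ≤ count A′ m)))
        finish (A₂ , (cand₂ , n≤) , least₂) = <-irrefl refl (begin-strict
          n₂ + n₂                 ≤⟨ +-mono-≤ n≤ n≤ ⟩
          κ + a₂ + (κ + a₂)       ≡⟨ interchange κ a₂ κ a₂ ⟩
          κ + κ + (a₂ + a₂)       <⟨ +-mono-<-≤ 2κ<∣B∣ (atom-doubling atom) ⟩
          length B + n₂           ≤⟨ +-monoˡ-≤ n₂ (∣B∣≤∣NA∣ (periodic cand₂) (nonempty cand₂)) ⟩
          n₂ + n₂                 ∎)
          where
          open ≤-Reasoning
          a₂ = count A₂ m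
          n₂ = count (N A₂) m
          atom : Atom κ A₂
          atom = record { candidate = cand₂ ; ∣NA∣≤ = n≤ ; minimal-κ = minimal-κ′
                        ; minimal = λ A′ c′ ≤κ → least₂ A′ (c′ , ≤κ) }

    -- ball k is the k-fold sumset of −B.
    ball : ℕ → ℕ → Bool
    ball zero    i = i % m ≡ᵇ 0
    ball (suc k) = N (ball k)

    ball-periodic : ∀ k → Periodic (ball k)
    ball-periodic zero    i = cong (_≡ᵇ 0) ([m+n]%n≡m%n i m)
    ball-periodic (suc k)   = N-periodic (ball-periodic k)

    ball-inhabited : ∀ k → T (ball k 0)
    ball-inhabited zero    = tt
    ball-inhabited (suc k) = ⊆N (ball-periodic k) 0 (ball-inhabited k)

    ball-nonempty : ∀ k → 1 ≤ count (ball k) m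
    ball-nonempty k = inhabited⇒count≥1 (ball-periodic k) 0 (ball-inhabited k)

    ball-sum : ∀ k i → T (ball k i) → ∃[ ss ] (length ss ≡ k × All (_∈ˡ B) ss × (i + sum ss) % m ≡ 0)
    ball-sum zero    i i≡0 = [] , refl , [] , trans (cong (_% m) (+-identityʳ i)) (≡ᵇ⇒≡ _ _ i≡0)
    ball-sum (suc k) i ∈ball with N-elim (ball k) ∈ball
    ... | b , b∈B , ∈ball′ with ball-sum k (i + b) ∈ball′
    ...   | ss , len , ss⊆B , ≡0 =
      b ∷ ss , cong suc len , b∈B ∷ ss⊆B , trans (cong (_% m) (sym (+-assoc i b (sum ss)))) ≡0

    -- The first step already yields all of `|B|`, not just half of it. Hence the factor `2 + k`,
    -- and with it the condition `2 * m ≤ suc k * length B` under which `k` steps fill the group.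
    ball-growth : ∀ k → m ≤ count (ball (suc k)) m ⊎ (2 + k) * length B ≤ 2 * count (ball (suc k)) m
    ball-growth zero = inj₂ (*-monoʳ-≤ 2 (∣B∣≤∣NA∣ (ball-periodic 0) (ball-nonempty 0)))
    ball-growth (suc k) with ball-growth k | count (ball (2 + k)) m <? m
    ... | _          | no  full  = inj₁ (≮⇒≥ full)
    ... | inj₁ full  | yes small = contradiction small
      (≤⇒≯ (≤-trans full (count-mono m (λ i _ → ⊆N (ball-periodic (suc k)) i))))
    ... | inj₂ grown | yes small = inj₂ (begin
      (3 + k) * length B                            ≡⟨ +-comm (length B) _ ⟩
      (2 + k) * length B + length B                 ≤⟨ +-monoˡ-≤ _ grown ⟩
      2 * count (ball (suc k)) m + length B         ≤⟨ growth (record { periodic = ball-periodic (suc k)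
                                                         ; nonempty = ball-nonempty (suc k) ; proper = small }) ⟩
      2 * count (ball (2 + k)) m                    ∎)
      where open ≤-Reasoning

    ball-full : ∀ k → 1 ≤ k → 2 * m ≤ suc k * length B → ∀ i → T (ball k i)
    ball-full (suc k) _ 2m≤ = count-full (ball-periodic (suc k))
      ([ id , (λ grown → *-cancelˡ-≤ 2 (≤-trans 2m≤ grown)) ]′ (ball-growth k))

    -- As `p * t` represents `−t`, the full ball supplies `k` elements of `B` whose sum is congruent
    -- to `t`. That sum is at most `k * m ≤ t`, so the remainder is a nonnegative multiple of `m`
    -- and can be filled with copies of `m`.
    sums-of-B : ∀ k → 1 ≤ k → 2 * m ≤ suc k * length B → ∀ t → k * m ≤ t →
                ∃[ ss ] (All (_∈ˡ B) ss × sum ss ≡ t × length ss * m ≤ k * m + t)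
    sums-of-B k 1≤k 2m≤ t km≤t with ball-sum k (p * t) (ball-full k 1≤k 2m≤ (p * t))
    ... | ss , refl , ss⊆B , ≡0 = ss ++ replicate n m , All.++⁺ ss⊆B (All.replicate⁺ n m∈B) , sum≡t , length≤
      where
      -- Since `p * t + t` is `t * m` and `p * t + sum ss` is `q * m`, exactly `t ∸ q` copies of `m`
      -- are missing.
      q = (p * t + sum ss) /ₙ m
      n = t ∸ q

      nm≡ : n * m ≡ t ∸ sum ss
      nm≡ = begin
        (t ∸ q) * m                       ≡⟨ *-distribʳ-∸ m t q ⟩
        t * m ∸ q * m                     ≡⟨ cong₂ _∸_ (rearrange t p) (sym (trans
                                               (m≡m%n+[m/n]*n (p * t + sum ss) m) (cong (_+ q * m) ≡0))) ⟩
        (p * t + t) ∸ (p * t + sum ss)    ≡⟨ [m+n]∸[m+o]≡n∸o (p * t) t (sum ss) ⟩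
        t ∸ sum ss                        ∎
        where
        open ≡-Reasoning
        rearrange : ∀ t p → t * suc p ≡ p * t + t
        rearrange = solve-∀

      sum-replicate : ∀ n x → sum (replicate n x) ≡ n * x
      sum-replicate zero    x = refl
      sum-replicate (suc n) x = cong (x +_) (sum-replicate n x)

      sum≡t : sum (ss ++ replicate n m) ≡ t
      sum≡t = begin
        sum (ss ++ replicate n m)       ≡⟨ sum-++ ss _ ⟩
        sum ss + sum (replicate n m)    ≡⟨ cong (sum ss +_) (trans (sum-replicate n m) nm≡) ⟩
        sum ss + (t ∸ sum ss)           ≡⟨ m+[n∸m]≡n (≤-trans (sum-≤-length* (All.map (proj₂ ∘ All.lookup bounds) ss⊆B)) km≤t) ⟩
        t                               ∎
        where open ≡-Reasoning

      length≤ : length (ss ++ replicate n m) * m ≤ length ss * m + t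
      length≤ = begin
        length (ss ++ replicate n m) * m ≡⟨ cong (_* m) (trans (length-++ ss) (cong (length ss +_) (length-replicate n))) ⟩
        (length ss + n) * m              ≡⟨ *-distribʳ-+ m (length ss) n ⟩
        length ss * m + n * m            ≤⟨ +-monoʳ-≤ (length ss * m) (≤-trans (≤-reflexive nm≡) (m∸n≤m t (sum ss))) ⟩
        length ss * m + t                ∎
        where open ≤-Reasoning

-- Subset sums and multiplicities up to permutation

⊆-resp-↭ : ∀ {Z X X′ : List ℕ} → Z ⊆ X → X ↭ X′ → ∃[ Z′ ] (Z′ ⊆ X′ × Z ↭ Z′)
⊆-resp-↭ Z⊆X ↭.refl = _ , Z⊆X , ↭.refl
⊆-resp-↭ (y ∷ʳ Z⊆X) (↭.prep _ X↭X′) with ⊆-resp-↭ Z⊆X X↭X′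
... | _ , Z′⊆X′ , Z↭Z′ = _ , y ∷ʳ Z′⊆X′ , Z↭Z′
⊆-resp-↭ (refl ∷ Z⊆X) (↭.prep x X↭X′) with ⊆-resp-↭ Z⊆X X↭X′
... | _ , Z′⊆X′ , Z↭Z′ = _ , refl ∷ Z′⊆X′ , ↭.prep x Z↭Z′
⊆-resp-↭ (x ∷ʳ (y ∷ʳ Z⊆X)) (↭.swap _ _ X↭X′) with ⊆-resp-↭ Z⊆X X↭X′
... | _ , Z′⊆X′ , Z↭Z′ = _ , y ∷ʳ (x ∷ʳ Z′⊆X′) , Z↭Z′
⊆-resp-↭ (x ∷ʳ (refl ∷ Z⊆X)) (↭.swap _ y X↭X′) with ⊆-resp-↭ Z⊆X X↭X′
... | _ , Z′⊆X′ , Z↭Z′ = _ , refl ∷ (x ∷ʳ Z′⊆X′) , ↭.prep y Z↭Z′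
⊆-resp-↭ (refl ∷ (y ∷ʳ Z⊆X)) (↭.swap x _ X↭X′) with ⊆-resp-↭ Z⊆X X↭X′
... | _ , Z′⊆X′ , Z↭Z′ = _ , y ∷ʳ (refl ∷ Z′⊆X′) , ↭.prep x Z↭Z′
⊆-resp-↭ (refl ∷ (refl ∷ Z⊆X)) (↭.swap x y X↭X′) with ⊆-resp-↭ Z⊆X X↭X′
... | _ , Z′⊆X′ , Z↭Z′ = _ , refl ∷ (refl ∷ Z′⊆X′) , ↭.swap x y Z↭Z′
⊆-resp-↭ Z⊆X (↭.trans X↭X₁ X₁↭X₂) with ⊆-resp-↭ Z⊆X X↭X₁
... | _ , Z₁⊆X₁ , Z↭Z₁ with ⊆-resp-↭ Z₁⊆X₁ X₁↭X₂
...   | _ , Z₂⊆X₂ , Z₁↭Z₂ = _ , Z₂⊆X₂ , ↭-trans Z↭Z₁ Z₁↭Z₂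

SubsetSums-resp-↭ : ∀ {X X′ s} → X ↭ X′ → SubsetSums X s → SubsetSums X′ s
SubsetSums-resp-↭ X↭X′ (Z , Z⊆X , refl) with ⊆-resp-↭ Z⊆X X↭X′
... | Z′ , Z′⊆X′ , Z↭Z′ = Z′ , Z′⊆X′ , sym (sum-↭ Z↭Z′)

SubsetSums-∷ : ∀ {X s} x → SubsetSums X s → SubsetSums (x ∷ X) (x + s)
SubsetSums-∷ x (Z , Z⊆X , refl) = x ∷ Z , refl ∷ Z⊆X , refl

SubsetSums-++ : ∀ {X Y s t} → SubsetSums X s → SubsetSums Y t → SubsetSums (X ++ Y) (s + t)
SubsetSums-++ (Z , Z⊆X , refl) (Z′ , Z′⊆Y , refl) = Z ++ Z′ , ++⁺ Z⊆X Z′⊆Y , sum-++ Z Z′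

multiplicity-resp-↭ : ∀ v {X X′} → X ↭ X′ → multiplicity v X ≡ multiplicity v X′
multiplicity-resp-↭ v X↭X′ = ↭-length (filter-↭ (v ≟_) X↭X′)

multiplicity-∷-≡ : ∀ v X → multiplicity v (v ∷ X) ≡ suc (multiplicity v X)
multiplicity-∷-≡ v X = cong length (filter-accept (v ≟_) refl)

multiplicity-∷-≢ : ∀ {v x} X → v ≢ x → multiplicity v (x ∷ X) ≡ multiplicity v X
multiplicity-∷-≢ {v} X v≢x = cong length (filter-reject (v ≟_) v≢x)

multiplicity-∷-≤ : ∀ v x X → multiplicity v X ≤ multiplicity v (x ∷ X)
multiplicity-∷-≤ v x X with v ≟ x
... | yes refl = ≤-trans (n≤1+n _) (≤-reflexive (sym (multiplicity-∷-≡ v X)))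
... | no  v≢x  = ≤-reflexive (sym (multiplicity-∷-≢ X v≢x))

multiplicity-++ : ∀ v X Y → multiplicity v (X ++ Y) ≡ multiplicity v X + multiplicity v Y
multiplicity-++ v X Y = trans (cong length (filter-++ (v ≟_) X Y)) (length-++ (filter (v ≟_) X))

multiplicity-≥1⇒∈ : ∀ v X → 1 ≤ multiplicity v X → v ∈ˡ X
multiplicity-≥1⇒∈ v (x ∷ X) 1≤ with v ≟ x
... | yes v≡x = here v≡x
... | no  v≢x = there (multiplicity-≥1⇒∈ v X (≤-trans 1≤ (≤-reflexive (multiplicity-∷-≢ X v≢x))))

multiplicity-map : ∀ (f g : ℕ → ℕ) → (∀ x → g (f x) ≡ x) → ∀ s X → multiplicity s (map f X) ≤ multiplicity (g s) X
multiplicity-map f g gf≗id s [] = z≤n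
multiplicity-map f g gf≗id s (x ∷ X) with s ≟ f x
... | no  s≢fx = ≤-trans (≤-reflexive (multiplicity-∷-≢ (map f X) s≢fx))
                   (≤-trans (multiplicity-map f g gf≗id s X) (multiplicity-∷-≤ (g s) x X))
... | yes refl rewrite multiplicity-∷-≡ (f x) (map f X) | cong (λ y → multiplicity y (x ∷ X)) (gf≗id x)
                     | multiplicity-∷-≡ x X =
  s≤s (≤-trans (multiplicity-map f g gf≗id (f x) X) (≤-reflexive (cong (λ y → multiplicity y X) (gf≗id x))))

-- Pair sums and their realisation by disjoint pairs

pairSums : List ℕ → List ℕ → List ℕ
pairSums A B = concatMap (λ a → map (a +_) B) A

length-pairSums : ∀ A B → length (pairSums A B) ≡ length A * length B
length-pairSums []      B = refl
length-pairSums (a ∷ A) B = trans (length-++ (map (a +_) B)) (cong₂ _+_ (length-map (a +_) B) (length-pairSums A B))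

pairSums-All : ∀ {A B W} → All (λ x → 1 ≤ x × x ≤ W) A → All (λ x → 1 ≤ x × x ≤ W) B →
               All (λ x → 1 ≤ x × x ≤ 2 * W) (pairSums A B)
pairSums-All [] B∈ = []
pairSums-All {W = W} (_∷_ {x = a} (1≤a , a≤W) A∈) B∈ = All.++⁺ 
  (All.map⁺ (All.map (λ (1≤b , b≤W) → ≤-trans 1≤a (m≤m+n a _) , +-mono-≤ a≤W (≤-trans b≤W (m≤m+n W 0))) B∈))
  (pairSums-All A∈ B∈)

pairCount : ℕ → List ℕ → List ℕ → ℕ
pairCount s A B = multiplicity s (pairSums A B)

∃-pair : ∀ s A B → 1 ≤ pairCount s A B → ∃[ a ] ∃[ b ] ∃[ A′ ] ∃[ B′ ] (A ↭ a ∷ A′ × B ↭ b ∷ B′ × s ≡ a + b)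
∃-pair s A B 1≤ = go A (multiplicity-≥1⇒∈ s (pairSums A B) 1≤)
  where
  extract : ∀ {x} {X : List ℕ} → x ∈ˡ X → ∃[ X′ ] (X ↭ x ∷ X′)
  extract x∈X with ∈-∃++ x∈X
  ... | ys , zs , refl = ys ++ zs , shift _ ys zs
  go : ∀ A → s ∈ˡ pairSums A B → ∃[ a ] ∃[ b ] ∃[ A′ ] ∃[ B′ ] (A ↭ a ∷ A′ × B ↭ b ∷ B′ × s ≡ a + b)
  go (a ∷ A) s∈ with ∈-++⁻ (map (a +_) B) s∈
  ... | inj₁ s∈a+B with ∈-map⁻ (a +_) s∈a+B
  ...   | b , b∈B , refl with extract b∈B
  ...     | B′ , B↭ = a , b , A , B′ , ↭.refl , B↭ , refl
  go (a ∷ A) s∈ | inj₂ s∈A+B with go A s∈A+B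
  ... | a′ , b , A′ , B′ , A↭ , B↭ , s≡ =
    a′ , b , a ∷ A′ , B′ , ↭-trans (↭.prep a A↭) (↭.swap a a′ ↭.refl) , B↭ , s≡

module _ {μ : ℕ} where

  Bounded : List ℕ → Set
  Bounded X = ∀ v → multiplicity v X ≤ μ

  -- Once `a` is fixed, its partner must equal `s ∸ a`, a value that occurs at most `μ` times in
  -- `B`.
  pairCount-∷ˡ : ∀ s a A B → Bounded B → pairCount s (a ∷ A) B ≤ μ + pairCount s A B
  pairCount-∷ˡ s a A B B≤μ = begin
    pairCount s (a ∷ A) B                            ≡⟨ multiplicity-++ s (map (a +_) B) _ ⟩
    multiplicity s (map (a +_) B) + pairCount s A B  ≤⟨ +-monoˡ-≤ _ (≤-trans
                                                          (multiplicity-map (a +_) (_∸ a) (m+n∸m≡n a) s B) (B≤μ _)) ⟩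
    μ + pairCount s A B                              ∎
    where open ≤-Reasoning

  pairCount-∷ʳ : ∀ s b A B → Bounded A → pairCount s A (b ∷ B) ≤ μ + pairCount s A B
  pairCount-∷ʳ s b A B A≤μ = begin
    pairCount s A (b ∷ B)                            ≡⟨ split A ⟩
    multiplicity s (map (_+ b) A) + pairCount s A B  ≤⟨ +-monoˡ-≤ _ (≤-trans
                                                          (multiplicity-map (_+ b) (_∸ b) (λ a → m+n∸n≡m a b) s A) (A≤μ _)) ⟩
    μ + pairCount s A B                              ∎
    where
    open ≤-Reasoning
    split : ∀ A → pairCount s A (b ∷ B) ≡ multiplicity s (map (_+ b) A) + pairCount s A B
    split []      = refl
    split (a ∷ A) = begin-equality
      multiplicity s (((a + b) ∷ map (a +_) B) ++ pairSums A (b ∷ B))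
        ≡⟨ multiplicity-++ s ((a + b) ∷ map (a +_) B) _ ⟩
      multiplicity s ((a + b) ∷ map (a +_) B) + pairCount s A (b ∷ B)
        ≡⟨ cong₂ _+_ (multiplicity-++ s [ a + b ] (map (a +_) B)) (split A) ⟩
      multiplicity s [ a + b ] + multiplicity s (map (a +_) B) + (multiplicity s (map (_+ b) A) + pairCount s A B)
        ≡⟨ interchange (multiplicity s [ a + b ]) (multiplicity s (map (a +_) B)) (multiplicity s (map (_+ b) A)) (pairCount s A B) ⟩
      multiplicity s [ a + b ] + multiplicity s (map (_+ b) A) + (multiplicity s (map (a +_) B) + pairCount s A B)
        ≡⟨ cong₂ _+_ (multiplicity-++ s [ a + b ] (map (_+ b) A)) (multiplicity-++ s (map (a +_) B) (pairSums A B)) ⟨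
      multiplicity s (map (_+ b) (a ∷ A)) + pairCount s (a ∷ A) B ∎

  pairCount-↭ˡ : ∀ s {A A′} B → A ↭ A′ → pairCount s A B ≡ pairCount s A′ B
  pairCount-↭ˡ s B A↭A′ = multiplicity-resp-↭ s (concatMap-↭ A↭A′)
    where
    concatMap-↭ : ∀ {A A′} → A ↭ A′ → pairSums A B ↭ pairSums A′ B
    concatMap-↭ ↭.refl = ↭.refl
    concatMap-↭ (↭.prep a p) = ++⁺ˡ (map (a +_) B) (concatMap-↭ p)
    concatMap-↭ (↭.swap a b p) = ↭-trans (shifts (map (a +_) B) (map (b +_) B))
      (++⁺ˡ (map (b +_) B) (++⁺ˡ (map (a +_) B) (concatMap-↭ p)))
    concatMap-↭ (↭.trans p q) = ↭-trans (concatMap-↭ p) (concatMap-↭ q)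

  pairCount-↭ʳ : ∀ s A {B B′} → B ↭ B′ → pairCount s A B ≡ pairCount s A B′
  pairCount-↭ʳ s []      p = refl
  pairCount-↭ʳ s (a ∷ A) {B} {B′} p = begin
    pairCount s (a ∷ A) B                              ≡⟨ multiplicity-++ s (map (a +_) B) _ ⟩
    multiplicity s (map (a +_) B) + pairCount s A B    ≡⟨ cong₂ _+_ (multiplicity-resp-↭ s (map⁺ (a +_) p)) (pairCount-↭ʳ s A p) ⟩
    multiplicity s (map (a +_) B′) + pairCount s A B′  ≡⟨ multiplicity-++ s (map (a +_) B′) _ ⟨
    pairCount s (a ∷ A) B′                             ∎
    where open ≡-Reasoning

  pairCount-≤ : ∀ s A B → Bounded B → pairCount s A B ≤ length A * μ
  pairCount-≤ s []      B B≤μ = z≤n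
  pairCount-≤ s (a ∷ A) B B≤μ = ≤-trans (pairCount-∷ˡ s a A B B≤μ) (+-monoʳ-≤ μ (pairCount-≤ s A B B≤μ))

  -- Each pair removed from A and B destroys at most 2 μ of the pairs with a given sum.
  popular-sums : 1 ≤ μ → ∀ ss A B → Bounded A → Bounded B →
                 All (λ s → 2 * μ * length ss ≤ pairCount s A B) ss →
                 SubsetSums (A ++ B) (sum ss)
  popular-sums 1≤μ ss A B A≤μ B≤μ pop with go ss A B A≤μ B≤μ pop
    where
    smaller : ∀ {X X′ x} → Bounded X → X ↭ x ∷ X′ → Bounded X′
    smaller {X} {X′} {x} X≤μ X↭ v = ≤-trans (multiplicity-∷-≤ v x X′)
      (≤-trans (≤-reflexive (sym (multiplicity-resp-↭ v X↭))) (X≤μ v))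
    -- The contributions of the two halves are kept apart, because every extracted pair permutes `A`
    -- and `B` separately.
    go : ∀ ss A B → Bounded A → Bounded B → All (λ s → 2 * μ * length ss ≤ pairCount s A B) ss →
         ∃[ x ] ∃[ y ] (SubsetSums A x × SubsetSums B y × x + y ≡ sum ss)
    go [] A B _ _ _ = 0 , 0 , ([] , minimum A , refl) , ([] , minimum B , refl) , refl
    go (s ∷ ss) A B A≤μ B≤μ (pop-s ∷ pop)
      with ∃-pair s A B (≤-trans 1≤μ (≤-trans (≤-trans (m≤m+n μ _) (m≤m*n (2 * μ) (suc (length ss)))) pop-s))
    ... | a , b , A′ , B′ , A↭ , B↭ , refl
      with go ss A′ B′ (smaller A≤μ A↭) (smaller B≤μ B↭) (All.map still pop)
      where
      still : ∀ {s} → 2 * μ * suc (length ss) ≤ pairCount s A B → 2 * μ * length ss ≤ pairCount s A′ B′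
      still {s} pop-s = +-cancelˡ-≤ (2 * μ) _ _ (begin
        2 * μ + 2 * μ * length ss        ≡⟨ *-suc (2 * μ) (length ss) ⟨
        2 * μ * suc (length ss)          ≤⟨ pop-s ⟩
        pairCount s A B                  ≡⟨ trans (pairCount-↭ˡ s B A↭) (pairCount-↭ʳ s (a ∷ A′) B↭) ⟩
        pairCount s (a ∷ A′) (b ∷ B′)    ≤⟨ pairCount-∷ˡ s a A′ (b ∷ B′) (λ v → ≤-trans (≤-reflexive (sym (multiplicity-resp-↭ v B↭))) (B≤μ v)) ⟩
        μ + pairCount s A′ (b ∷ B′)      ≤⟨ +-monoʳ-≤ μ (pairCount-∷ʳ s b A′ B′ (smaller A≤μ A↭)) ⟩
        μ + (μ + pairCount s A′ B′)      ≡⟨ rearrange μ _ ⟩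
        2 * μ + pairCount s A′ B′        ∎)
        where
        open ≤-Reasoning
        rearrange : ∀ m n → m + (m + n) ≡ 2 * m + n
        rearrange = solve-∀
    ...   | x , y , x∈ , y∈ , x+y≡ =
      a + x , b + y , SubsetSums-resp-↭ (↭-sym A↭) (SubsetSums-∷ a x∈) ,
      SubsetSums-resp-↭ (↭-sym B↭) (SubsetSums-∷ b y∈) , trans (interchange a x b y) (cong (a + b +_) x+y≡)
  ... | x , y , x∈ , y∈ , x+y≡ = subst (SubsetSums (A ++ B)) x+y≡ (SubsetSums-++ x∈ y∈)

-- Zero-sum blocks and multiples of `d` among subset sums

%-≡⇒∣ : ∀ d .{{_ : NonZero d}} x v → (x + v) % d ≡ x % d → d ∣ v
%-≡⇒∣ d x v eq = ∣m+n∣m⇒∣n {m = x /ₙ d * d} (subst (d ∣_) (sym x/d*d+v) (n∣m*n ((x + v) /ₙ d))) (n∣m*n (x /ₙ d))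
  where
  x/d*d+v : x /ₙ d * d + v ≡ (x + v) /ₙ d * d
  x/d*d+v = +-cancelˡ-≡ (x % d) _ _ (begin
    x % d + (x /ₙ d * d + v)          ≡⟨ +-assoc (x % d) _ v ⟨
    x % d + x /ₙ d * d + v            ≡⟨ cong (_+ v) (m≡m%n+[m/n]*n x d) ⟨
    x + v                            ≡⟨ m≡m%n+[m/n]*n (x + v) d ⟩
    (x + v) % d + (x + v) /ₙ d * d    ≡⟨ cong (_+ (x + v) /ₙ d * d) eq ⟩
    x % d + (x + v) /ₙ d * d          ∎)
    where open ≡-Reasoning

take-+ : ∀ i k (R : List ℕ) → take (i + k) R ≡ take i R ++ take k (drop i R)
take-+ zero    k R       = refl
take-+ (suc i) zero []   = refl
take-+ (suc i) (suc k) []   = refl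
take-+ (suc i) k (x ∷ R) = cong (x ∷_) (take-+ i k R)

-- Of the `d + 1` prefix sums with 0, ..., `d` terms, two agree modulo `d`; `V` is the stretch
-- between them.
zero-sum-block : ∀ d .{{_ : NonZero d}} R → d ≤ length R →
                 ∃[ V ] ∃[ R′ ] (R ↭ V ++ R′ × 1 ≤ length V × length V ≤ d × d ∣ sum V)
zero-sum-block d R d≤∣R∣ with pigeonhole (n<1+n d) (λ i → fromℕ< (m%n<n (sum (take (toℕ i) R)) d))
... | i , j , i<j , eq = V , take a R ++ drop k (drop a R) , perm , 1≤∣V∣ , ∣V∣≤d , d∣V
  where
  a = toℕ i
  k = toℕ j ∸ a
  V = take k (drop a R)

  j≤d : toℕ j ≤ d
  j≤d = ≤-pred (toℕ<n j)

  ∣V∣≡ : length V ≡ k ⊓ (length R ∸ a)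
  ∣V∣≡ = trans (length-take k (drop a R)) (cong (k ⊓_) (length-drop a R))

  1≤∣V∣ : 1 ≤ length V
  1≤∣V∣ = ≤-trans (⊓-glb (m<n⇒0<n∸m i<j) (m<n⇒0<n∸m (<-≤-trans i<j (≤-trans j≤d d≤∣R∣)))) (≤-reflexive (sym ∣V∣≡))

  ∣V∣≤d : length V ≤ d
  ∣V∣≤d = ≤-trans (≤-reflexive ∣V∣≡) (≤-trans (m⊓n≤m k _) (≤-trans (m∸n≤m (toℕ j) a) j≤d))

  perm : R ↭ V ++ take a R ++ drop k (drop a R)
  perm = ↭-trans (↭-reflexive (sym (trans (cong (take a R ++_) (take++drop≡id k (drop a R))) (take++drop≡id a R))))
                 (shifts (take a R) V)

  sum-take-j : sum (take (toℕ j) R) ≡ sum (take a R) + sum V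
  sum-take-j = begin
    sum (take (toℕ j) R)      ≡⟨ cong (λ n → sum (take n R)) (m+[n∸m]≡n (<⇒≤ i<j)) ⟨
    sum (take (a + k) R)      ≡⟨ cong sum (take-+ a k R) ⟩
    sum (take a R ++ V)       ≡⟨ sum-++ (take a R) V ⟩
    sum (take a R) + sum V    ∎
    where open ≡-Reasoning

  d∣V : d ∣ sum V
  d∣V = %-≡⇒∣ d (sum (take a R)) (sum V)
    (trans (cong (_% d) (sym sum-take-j)) (sym (fromℕ<-injective _ _ _ _ eq)))

-- Zero-sum blocks are collected until the quotient `q₀` reaches `A`. A block has at most `d`
-- entries, each at most `W`, so it raises the quotient by at most `W` and the last one cannot
-- overshoot `A + W`. The argument `n` of `go` only bounds the recursion.
multiple-in-SubsetSums : ∀ d .{{_ : NonZero d}} A W Y → All (_≤ W) Y → d * A + d * W ≤ sum Y →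
                         ∃[ q ] (A ≤ q × q ≤ A + W × SubsetSums Y (d * q))
multiple-in-SubsetSums d A W Y Y≤W large
  with go (length Y) 0 Y ≤-refl Y≤W z≤n (≤-trans large (m≤n+m _ (d * 0)))
  where
  go : ∀ n q₀ R → length R ≤ n → All (_≤ W) R → q₀ ≤ A + W → d * A + d * W ≤ d * q₀ + sum R →
       ∃[ q ] ∃[ t ] (A ≤ q × q ≤ A + W × SubsetSums R t × d * q₀ + t ≡ d * q)
  go n q₀ R ∣R∣≤n R≤W q₀≤ large with A ≤? q₀
  ... | yes A≤q₀ = q₀ , 0 , A≤q₀ , q₀≤ , ([] , minimum R , refl) , +-identityʳ _
  ... | no  A≰q₀ with d ≤? length R
  -- Fewer than `d` remaining entries sum to at most `d * W`, so the invariant on `d * q₀ + sum R`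
  -- would already force `A ≤ q₀`.
  ...   | no  d≰∣R∣ = contradiction (*-cancelˡ-≤ d (+-cancelʳ-≤ (d * W) _ _ (≤-trans large
            (+-monoʳ-≤ (d * q₀) (≤-trans (sum-≤-length* R≤W) (*-monoˡ-≤ W (<⇒≤ (≰⇒> d≰∣R∣)))))))) A≰q₀
  ...   | yes d≤∣R∣ with zero-sum-block d R d≤∣R∣
  ...     | V , R′ , R↭ , 1≤∣V∣ , ∣V∣≤d , divides v sumV≡ = continue n ∣R∣≤n
    where
    VR′≤W : All (_≤ W) (V ++ R′)
    VR′≤W = All-resp-↭ R↭ R≤W

    ∣R∣≡ : length R ≡ length V + length R′
    ∣R∣≡ = trans (↭-length R↭) (length-++ V)

    v≤W : v ≤ W
    v≤W = *-cancelʳ-≤ v W d (begin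
      v * d          ≡⟨ sumV≡ ⟨
      sum V          ≤⟨ sum-≤-length* (All.++⁻ˡ V VR′≤W) ⟩
      length V * W   ≤⟨ *-monoˡ-≤ W ∣V∣≤d ⟩
      d * W          ≡⟨ *-comm d W ⟩
      W * d          ∎)
      where open ≤-Reasoning

    advance : ∀ t → d * q₀ + (sum V + t) ≡ d * (q₀ + v) + t
    advance t = trans (cong (λ s → d * q₀ + (s + t)) sumV≡) (rearrange d q₀ v t)
      where
      rearrange : ∀ d q v t → d * q + (v * d + t) ≡ d * (q + v) + t
      rearrange = solve-∀

    continue : ∀ n → length R ≤ n → ∃[ q ] ∃[ t ] (A ≤ q × q ≤ A + W × SubsetSums R t × d * q₀ + t ≡ d * q)
    continue zero ∣R∣≤0 = contradiction (≤-trans 1≤∣V∣ (≤-trans (m≤m+n _ _) (≤-trans (≤-reflexive (sym ∣R∣≡)) ∣R∣≤0))) λ()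
    continue (suc n) ∣R∣≤1+n
      with go n (q₀ + v) R′
             (≤-pred (≤-trans (+-monoˡ-≤ _ 1≤∣V∣) (≤-trans (≤-reflexive (sym ∣R∣≡)) ∣R∣≤1+n)))
             (All.++⁻ʳ V VR′≤W)
             (+-mono-≤ (<⇒≤ (≰⇒> A≰q₀)) v≤W)
             (≤-trans large (≤-reflexive (trans (cong (d * q₀ +_) (trans (sum-↭ R↭) (sum-++ V R′))) (advance (sum R′)))))
    ... | q , t , A≤q , q≤ , t∈ , eq =
      q , sum V + t , A≤q , q≤ ,
      SubsetSums-resp-↭ (↭-sym R↭) (SubsetSums-++ (V , ⊆-refl , refl) t∈) , trans (advance t) eq
... | q , t , A≤q , q≤ , t∈ , eq = q , A≤q , q≤ , subst (SubsetSums Y) (trans (cong (_+ t) (sym (*-zeroʳ d))) eq) t∈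

-- Powers of two and dyadic pigeonholing

n≤2^⌈log₂n⌉ : ∀ n → n ≤ 2 ^ ⌈log₂ n ⌉
n≤2^⌈log₂n⌉ n = go ⌈log₂ n ⌉ n refl
  where
  go : ∀ L n → ⌈log₂ n ⌉ ≡ L → n ≤ 2 ^ L
  go zero    0 _ = z≤n
  go zero    1 _ = ≤-refl
  go (suc L) n eq = begin
    n                      ≡⟨ ⌊n/2⌋+⌈n/2⌉≡n n ⟨
    ⌊ n /2⌋ + ⌈ n /2⌉      ≤⟨ +-monoˡ-≤ ⌈ n /2⌉ (⌊n/2⌋≤⌈n/2⌉ n) ⟩
    ⌈ n /2⌉ + ⌈ n /2⌉      ≤⟨ +-mono-≤ half (≤-trans half (m≤m+n _ 0)) ⟩
    2 ^ suc L              ∎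
    where
    open ≤-Reasoning
    half : ⌈ n /2⌉ ≤ 2 ^ L
    half = go L ⌈ n /2⌉ (trans (⌈log₂⌈n/2⌉⌉≡⌈log₂n⌉∸1 n) (cong (_∸ 1) eq))

∃-power-of-2 : ∀ n → 1 ≤ n → ∃[ J ] (n < 2 ^ J × 2 ^ J ≤ 2 * n)
∃-power-of-2 1             _ = 1 , ≤-refl , ≤-refl
∃-power-of-2 (suc (suc n)) _ with ∃-power-of-2 (suc n) (s≤s z≤n)
... | J , n<2^J , 2^J≤2n with m≤n⇒m<n∨m≡n n<2^J
...   | inj₁ 1+n<2^J = J , 1+n<2^J , ≤-trans 2^J≤2n (*-monoʳ-≤ 2 (n≤1+n (suc n)))
...   | inj₂ 2+n≡2^J = suc J , ≤-<-trans (≤-reflexive 2+n≡2^J) (m<m+n (2 ^ J) (≤-trans (m^n>0 2 J) (m≤m+n _ 0))) ,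
                       ≤-reflexive (cong (2 *_) (sym 2+n≡2^J))

sumTo-*ˡ : ∀ c f n → sumTo (λ i → c * f i) n ≡ c * sumTo f n
sumTo-*ˡ c f zero    = sym (*-zeroʳ c)
sumTo-*ˡ c f (suc n) = trans (cong (_+ c * f n) (sumTo-*ˡ c f n)) (sym (*-distribˡ-+ c (sumTo f n) (f n)))

sumTo-const+2^ : ∀ a c J → sumTo (λ j → a + 2 ^ j * c) J ≤ J * a + 2 ^ J * c
sumTo-const+2^ a c zero    = z≤n
sumTo-const+2^ a c (suc J) = begin
  sumTo (λ j → a + 2 ^ j * c) J + (a + 2 ^ J * c)  ≤⟨ +-monoˡ-≤ _ (sumTo-const+2^ a c J) ⟩
  J * a + 2 ^ J * c + (a + 2 ^ J * c)              ≡⟨ rearrange (J * a) (2 ^ J) c a ⟩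
  a + J * a + 2 * 2 ^ J * c                        ∎
  where
  open ≤-Reasoning
  rearrange : ∀ x y c a → x + y * c + (a + y * c) ≡ a + x + 2 * y * c
  rearrange = solve-∀

module _ (f : ℕ → ℕ) where

  superlevel : ℕ → List ℕ → List ℕ
  superlevel τ = filter (λ s → τ ≤? f s)

  length-superlevel-∷ : ∀ τ s S → length (superlevel τ (s ∷ S)) ≡ length (superlevel τ [ s ]) + length (superlevel τ S)
  length-superlevel-∷ τ s S = trans (cong length (filter-++ (λ s → τ ≤? f s) [ s ] S)) (length-++ (superlevel τ [ s ]))

  -- The bound c in place of f s makes the induction on J go through.
  dyadic-digits : ∀ J s c → c ≤ f s → c < 2 ^ J → c ≤ sumTo (λ j → 2 ^ j * length (superlevel (2 ^ j) [ s ])) J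
  dyadic-digits zero    s .0 c≤ (s≤s z≤n) = z≤n
  dyadic-digits (suc J) s c c≤ c<2^ with 2 ^ J ≤? f s
  ... | no  2^J≰ = ≤-trans (dyadic-digits J s c c≤ (≤-<-trans c≤ (≰⇒> 2^J≰))) (m≤m+n _ _)
  ... | yes 2^J≤ = begin
    c                             ≤⟨ m≤n+m∸n c (2 ^ J) ⟩
    2 ^ J + (c ∸ 2 ^ J)           ≤⟨ +-monoʳ-≤ (2 ^ J) (dyadic-digits J s (c ∸ 2 ^ J) (≤-trans (m∸n≤m c (2 ^ J)) c≤) smaller) ⟩
    2 ^ J + lower                 ≡⟨ +-comm (2 ^ J) lower ⟩
    lower + 2 ^ J                 ≡⟨ cong (lower +_) (*-identityʳ (2 ^ J)) ⟨
    lower + 2 ^ J * 1             ≡⟨ cong (λ xs → lower + 2 ^ J * length xs) (filter-accept (λ s → 2 ^ J ≤? f s) 2^J≤) ⟨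
    lower + 2 ^ J * length (superlevel (2 ^ J) [ s ]) ∎
    where
    open ≤-Reasoning
    lower = sumTo (λ j → 2 ^ j * length (superlevel (2 ^ j) [ s ])) J
    smaller : c ∸ 2 ^ J < 2 ^ J
    smaller with 2 ^ J ≤? c
    ... | yes 2^J≤c = +-cancelʳ-< (2 ^ J) _ _ (≤-trans (s≤s (≤-reflexive (m∸n+n≡m 2^J≤c)))
                        (≤-trans c<2^ (≤-reflexive (cong (2 ^ J +_) (+-identityʳ _)))))
    ... | no  2^J≰c = ≤-trans (s≤s (m∸n≤m c (2 ^ J))) (≰⇒> 2^J≰c)

  dyadic-sum : ∀ J S → (∀ s → f s < 2 ^ J) → sum (map f S) ≤ sumTo (λ j → 2 ^ j * length (superlevel (2 ^ j) S)) J
  dyadic-sum J []      f<2^J = z≤n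
  dyadic-sum J (s ∷ S) f<2^J = begin
    f s + sum (map f S)                   ≤⟨ +-mono-≤ (dyadic-digits J s (f s) ≤-refl (f<2^J s)) (dyadic-sum J S f<2^J) ⟩
    sumTo g₁ J + sumTo g₂ J               ≡⟨ sumTo-+ g₁ g₂ J ⟨
    sumTo (λ j → g₁ j + g₂ j) J           ≡⟨ sumTo-cong J (λ j _ → trans (sym (*-distribˡ-+ (2 ^ j) _ _))
                                               (cong (2 ^ j *_) (sym (length-superlevel-∷ (2 ^ j) s S)))) ⟩
    sumTo (λ j → 2 ^ j * length (superlevel (2 ^ j) (s ∷ S))) J ∎
    where
    open ≤-Reasoning
    g₁ g₂ : ℕ → ℕ
    g₁ j = 2 ^ j * length (superlevel (2 ^ j) [ s ])
    g₂ j = 2 ^ j * length (superlevel (2 ^ j) S)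

length≤sum-multiplicities : ∀ {Q} S → All (_∈ˡ S) Q → length Q ≤ sum (map (λ s → multiplicity s Q) S)
length≤sum-multiplicities S [] = z≤n
length≤sum-multiplicities {x ∷ Q} S (x∈S ∷ Q⊆S) = ≤-trans (s≤s (length≤sum-multiplicities S Q⊆S)) (increase S x∈S)
  where
  weak : ∀ S → sum (map (λ s → multiplicity s Q) S) ≤ sum (map (λ s → multiplicity s (x ∷ Q)) S)
  weak []      = z≤n
  weak (s ∷ S) = +-mono-≤ (multiplicity-∷-≤ s x Q) (weak S)
  increase : ∀ S → x ∈ˡ S → sum (map (λ s → multiplicity s Q) S) < sum (map (λ s → multiplicity s (x ∷ Q)) S)
  increase (_ ∷ S) (here refl) = +-mono-<-≤ (≤-reflexive (sym (multiplicity-∷-≡ x Q))) (weak S)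
  increase (s ∷ S) (there x∈S) = +-mono-≤-< (multiplicity-∷-≤ s x Q) (increase S x∈S)

popular-level : ∀ Q n J a c C → All (_< n) Q → (∀ s → multiplicity s Q < 2 ^ J) →
  J * a + 2 ^ J * c < C * length Q →
  ∃[ j ] (a + 2 ^ j * c < C * (2 ^ j * length (superlevel (λ s → multiplicity s Q) (2 ^ j) (downFrom n))))
popular-level Q n J a c C Q<n bounded large =
  let j , _ , good = ∃-sumTo-< (λ j → a + 2 ^ j * c) (λ j → C * g j) J (begin-strict
        sumTo (λ j → a + 2 ^ j * c) J        ≤⟨ sumTo-const+2^ a c J ⟩
        J * a + 2 ^ J * c                    <⟨ large ⟩
        C * length Q                         ≤⟨ *-monoʳ-≤ C (length≤sum-multiplicities (downFrom n) (All.map ∈-downFrom⁺ Q<n)) ⟩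
        C * sum (map (λ s → multiplicity s Q) (downFrom n)) ≤⟨ *-monoʳ-≤ C (dyadic-sum _ J (downFrom n) bounded) ⟩
        C * sumTo g J                        ≡⟨ sumTo-*ˡ C g J ⟨
        sumTo (λ j → C * g j) J              ∎)
  in j , good
  where
  open ≤-Reasoning
  g : ℕ → ℕ
  g j = 2 ^ j * length (superlevel (λ s → multiplicity s Q) (2 ^ j) (downFrom n))

downFrom-descending : ∀ n → AllPairs _>_ (downFrom n)
downFrom-descending zero    = []
downFrom-descending (suc n) = All.tabulate ∈-downFrom⁻ ∷ downFrom-descending n

-- From ℤ/m back to multiples of the gcd

gcds-∣ : ∀ xs → All (gcds xs ∣_) xs
gcds-∣ []       = []
gcds-∣ (x ∷ xs) = gcd[m,n]∣m x (gcds xs) ∷ All.map (∣-trans (gcd[m,n]∣n x (gcds xs))) (gcds-∣ xs)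

gcds-* : ∀ d xs → gcds (map (d *_) xs) ≡ d * gcds xs
gcds-* d []       = sym (*-zeroʳ d)
gcds-* d (x ∷ xs) = trans (cong (gcd (d * x)) (gcds-* d xs)) (sym (c*gcd[m,n]≡gcd[cm,cn] d x (gcds xs)))

All-∣⇒map : ∀ {d xs} → All (d ∣_) xs → ∃[ ys ] (xs ≡ map (d *_) ys)
All-∣⇒map [] = [] , refl
All-∣⇒map {d} (divides y refl ∷ d∣xs) with All-∣⇒map d∣xs
... | ys , refl = y ∷ ys , cong (_∷ map (d *_) ys) (*-comm y d)

sum-map-* : ∀ d xs → sum (map (d *_) xs) ≡ d * sum xs
sum-map-* d []       = sym (*-zeroʳ d)
sum-map-* d (x ∷ xs) = trans (cong (_+_ (d * x)) (sum-map-* d xs)) (sym (*-distribˡ-+ d x (sum xs)))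

-- The head of a descending list is its maximum. Dividing by `d = gcds B` leaves a list `D` with gcd
-- 1 and maximum `m`, to which the argument in ℤ/m applies; here `m` is the maximum of `B` divided
-- by `d`.
multiples-as-sums : ∀ N B → AllPairs _>_ B → All (λ x → 1 ≤ x × x ≤ N) B → 1 ≤ length B →
  ∃[ d ] ∃[ m ] ∃[ k ] (1 ≤ d × 1 ≤ m × 1 ≤ k × d * m ≤ N × length B ≤ m × k * length B ≤ 2 * m ×
    (∀ q → k * m ≤ q → ∃[ ss ] (All (_∈ˡ B) ss × sum ss ≡ d * q × length ss * m ≤ k * m + q)))
multiples-as-sums N B B↓ bounds 1≤b with All-∣⇒map (gcds-∣ B)
... | []        , B≡ = contradiction (≤-trans 1≤b (≤-reflexive (cong length B≡))) λ()
... | zero ∷ B′ , B≡ = contradiction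
  (≤-trans (proj₁ (All.head (subst (All (λ x → 1 ≤ x × x ≤ N)) B≡ bounds))) (≤-reflexive (*-zeroʳ (gcds B)))) λ()
... | suc p ∷ B′ , B≡ = d , m , k , 1≤d , s≤s z≤n , 1≤k , dm≤N , b≤m , m/n*n≤m (2 * m) b , sums
  where
  d = gcds B
  m = suc p
  b = length B
  D = m ∷ B′

  instance
    _ : NonZero b
    _ = >-nonZero 1≤b

  -- The floor gives both `k * b ≤ 2 * m`, which limits the cost, and `2 * m ≤ suc k * b`, which
  -- fills the group.
  k = 2 * m /ₙ b

  bounds′ : All (λ x → 1 ≤ x × x ≤ N) (map (d *_) D)
  bounds′ = subst (All _) B≡ bounds

  1≤d : 1 ≤ d
  1≤d = n≢0⇒n>0 λ d≡0 → contradiction (≤-trans (proj₁ (All.head bounds′)) (≤-reflexive (cong (_* m) d≡0))) λ()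

  instance
    _ : NonZero d
    _ = >-nonZero 1≤d

  dm≤N : d * m ≤ N
  dm≤N = proj₂ (All.head bounds′)

  D↓ : AllPairs _>_ D
  D↓ = AllPairs.map (*-cancelˡ-< d _ _) (AllPairs.map⁻ (subst (AllPairs _>_) B≡ B↓))

  D≤m : All (λ x → 1 ≤ x × x ≤ m) D
  D≤m = All.zipWith (λ (1≤dx , x≤m) → positive 1≤dx , x≤m)
          (All.map⁻ (All.map proj₁ bounds′) , ≤-refl ∷ All.map <⇒≤ (AllPairs.head D↓))
    where
    positive : ∀ {x} → 1 ≤ d * x → 1 ≤ x
    positive {zero}  1≤ = ≤-trans 1≤ (≤-reflexive (*-zeroʳ d))
    positive {suc x} _  = s≤s z≤n

  gcds-D : gcds D ≡ 1
  gcds-D = *-cancelˡ-≡ (gcds D) 1 d (begin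
    d * gcds D              ≡⟨ gcds-* d D ⟨
    gcds (map (d *_) D)     ≡⟨ cong gcds B≡ ⟨
    d                       ≡⟨ *-identityʳ d ⟨
    d * 1                   ∎)
    where open ≡-Reasoning

  ∣D∣≡b : length D ≡ b
  ∣D∣≡b = trans (sym (length-map (d *_) D)) (cong length (sym B≡))

  b≤m : b ≤ m
  b≤m = begin
    b                       ≡⟨ ∣D∣≡b ⟨
    length D                ≤⟨ length≤count (λ _ → true) m D↓ D≤m (All.universal _ D) ⟩
    count (λ _ → true) m    ≤⟨ count-≤ (λ _ → true) m ⟩
    m                       ∎
    where
    open ≤-Reasoning

  1≤k : 1 ≤ k
  1≤k = m≥n⇒m/n>0 {2 * m} {b} (≤-trans b≤m (m≤m+n m _))

  2m≤[1+k]b : 2 * m ≤ suc k * length D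
  2m≤[1+k]b = begin
    2 * m                     ≡⟨ m≡m%n+[m/n]*n (2 * m) b ⟩
    2 * m % b + k * b         ≤⟨ +-monoˡ-≤ (k * b) (<⇒≤ (m%n<n (2 * m) b)) ⟩
    suc k * b                 ≡⟨ cong (suc k *_) ∣D∣≡b ⟨
    suc k * length D          ∎
    where open ≤-Reasoning

  sums : ∀ q → k * m ≤ q → ∃[ ss ] (All (_∈ˡ B) ss × sum ss ≡ d * q × length ss * m ≤ k * m + q)
  sums q km≤q with Cyclic.sums-of-B p D D↓ D≤m (here refl) gcds-D k 1≤k 2m≤[1+k]b q km≤q
  ... | ss , ss⊆D , sum≡q , length≤ =
    map (d *_) ss ,
    All.map⁺ (All.map (λ {x} x∈D → subst (d * x ∈ˡ_) (sym B≡) (∈-map⁺ (d *_) x∈D)) ss⊆D) ,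
    trans (sum-map-* d ss) (cong (d *_) sum≡q) ,
    ≤-trans (≤-reflexive (cong (_* m) (length-map (d *_) ss))) length≤

-- Numerical estimates and assembly

-- With `r = h + h′`, the right side is `32 μ r²` up to parity. Density bounds the first term by
-- `9 μ r²`, as 2304 · 2 = 9 · 512, and the second is at most `5 μ r²`. An odd `r` loses `32 μ`,
-- which `512 ≤ r²` absorbs with strictness to spare.
pairs-abundant : ∀ h h′ μ W J Λ P → 1 ≤ μ → h ≤ h′ → h′ ≤ suc h →
  J ≤ 2 * Λ → P ≤ 2 * (h * μ) → 512 * μ * W * Λ ≤ (h + h′) * (h + h′) → 512 ≤ (h + h′) * (h + h′) →
  J * (2304 * (μ * μ * W)) + P * (5 * (h + h′)) < 128 * μ * (h * h′)
pairs-abundant h h′ μ W J Λ P 1≤μ h≤h′ h′≤1+h J≤2Λ P≤2hμ dense 512≤r² =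
  +-cancelʳ-< (32 * μ) _ _ (begin-strict
    J * (2304 * (μ * μ * W)) + P * (5 * r) + 32 * μ
      ≤⟨ +-monoˡ-≤ (32 * μ) (+-mono-≤ (*-monoˡ-≤ _ J≤2Λ) (*-monoˡ-≤ (5 * r) P≤2hμ)) ⟩
    2 * Λ * (2304 * (μ * μ * W)) + 2 * (h * μ) * (5 * r) + 32 * μ
      ≡⟨ factor Λ μ W h r ⟩
    μ * (9 * (512 * μ * W * Λ) + 5 * ((h + h) * r) + 32)
      ≤⟨ *-monoʳ-≤ μ (+-monoˡ-≤ 32 (+-mono-≤ (*-monoʳ-≤ 9 dense) (*-monoʳ-≤ 5 (*-monoˡ-≤ r (+-monoʳ-≤ h h≤h′))))) ⟩
    μ * (9 * (r * r) + 5 * (r * r) + 32)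
      <⟨ *-monoʳ-< μ (+-monoʳ-< (9 * (r * r) + 5 * (r * r)) (<-≤-trans (m≤m+n 33 479) 512≤r²)) ⟩
    μ * (9 * (r * r) + 5 * (r * r) + r * r)
      ≤⟨ *-monoʳ-≤ μ (≤-trans (m≤m+n _ (17 * (r * r))) (≤-reflexive (collect (r * r)))) ⟩
    μ * (32 * (r * r))
      ≤⟨ *-monoʳ-≤ μ (*-monoʳ-≤ 32 square) ⟩
    μ * (32 * (4 * (h * h′) + 1))
      ≡⟨ expand μ (h * h′) ⟩
    128 * μ * (h * h′) + 32 * μ ∎)
  where
  open ≤-Reasoning
  r = h + h′
  instance
    _ : NonZero μ
    _ = >-nonZero 1≤μ
  factor : ∀ Λ μ W h r → 2 * Λ * (2304 * (μ * μ * W)) + 2 * (h * μ) * (5 * r) + 32 * μ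
                       ≡ μ * (9 * (512 * μ * W * Λ) + 5 * ((h + h) * r) + 32)
  factor = solve-∀
  collect : ∀ s → 9 * s + 5 * s + s + 17 * s ≡ 32 * s
  collect = solve-∀
  expand : ∀ μ x → μ * (32 * (4 * x + 1)) ≡ 128 * μ * x + 32 * μ
  expand = solve-∀
  odd-square : ∀ h → (h + suc h) * (h + suc h) ≡ 4 * (h * suc h) + 1
  odd-square = solve-∀
  even-square : ∀ h → (h + h) * (h + h) ≡ 4 * (h * h)
  even-square = solve-∀
  square : r * r ≤ 4 * (h * h′) + 1
  square with m≤n⇒m<n∨m≡n h≤h′
  ... | inj₂ refl = ≤-trans (≤-reflexive (even-square h)) (m≤m+n _ 1)
  ... | inj₁ h<h′ with ≤-antisym h<h′ h′≤1+h
  ...   | refl = ≤-reflexive (odd-square h)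

<*⇒positive : ∀ {x} c n → x < c * n → 1 ≤ n
<*⇒positive c zero    x<0 = contradiction (<-≤-trans x<0 (≤-reflexive (*-zeroʳ c))) λ()
<*⇒positive c (suc _) _   = s≤s z≤n

popular-multiples-intersect : ∀ {μ} W r τ A₁ A₂ Y B → 1 ≤ μ → 1 ≤ r →
  (∀ v → multiplicity v A₁ ≤ μ) → (∀ v → multiplicity v A₂ ≤ μ) → All (_≤ W) Y →
  AllPairs _>_ B → All (λ s → 1 ≤ s × s ≤ 2 * W) B → All (λ s → τ ≤ pairCount s A₁ A₂) B →
  18 * μ * W < τ * length B → 5 * r < 128 * μ * length B → 256 * μ * (W * W) ≤ sum Y * r →
  ∃[ s ] (0 < s × SubsetSums (A₁ ++ A₂) s × SubsetSums Y s)
popular-multiples-intersect {μ} W r τ A₁ A₂ Y B 1≤μ 1≤r A₁≤μ A₂≤μ Y≤W B↓ B∈ popular 18μW<τb 5r<128μb heavy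
  with multiples-as-sums (2 * W) B B↓ B∈ (<*⇒positive (128 * μ) (length B) 5r<128μb)
... | d , m , k , 1≤d , 1≤m , 1≤k , dm≤2W , b≤m , kb≤2m , sums =
  meet (multiple-in-SubsetSums d (k * m) W Y Y≤W enough)
  where
  open ≤-Reasoning
  b = length B
  instance
    _ : NonZero r
    _ = >-nonZero 1≤r
    _ : NonZero d
    _ = >-nonZero 1≤d
    _ : NonZero m
    _ = >-nonZero 1≤m
    _ : NonZero b
    _ = >-nonZero (<*⇒positive (128 * μ) (length B) 5r<128μb)

  m≤2W : m ≤ 2 * W
  m≤2W = ≤-trans (m≤n*m m d) dm≤2W

  -- After multiplication by `b` the two terms are at most `8 W²` and `2 W²`. Their total `10 W²` is
  -- where the 5 in `5 * r` comes from.
  enough : d * (k * m) + d * W ≤ sum Y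
  enough = *-cancelˡ-≤ (r * b) (begin
    r * b * (d * (k * m) + d * W)              ≡⟨ regroup₁ r b d k m W ⟩
    r * (k * b * (d * m) + d * b * W)          ≤⟨ *-monoʳ-≤ r (+-mono-≤ (*-mono-≤ (≤-trans kb≤2m (*-monoʳ-≤ 2 m≤2W)) dm≤2W)
                                                    (*-monoˡ-≤ W (≤-trans (*-monoʳ-≤ d b≤m) dm≤2W))) ⟩
    r * (2 * (2 * W) * (2 * W) + 2 * W * W)    ≡⟨ regroup₂ r W ⟩
    2 * (W * W) * (5 * r)                      ≤⟨ *-monoʳ-≤ (2 * (W * W)) (<⇒≤ 5r<128μb) ⟩
    2 * (W * W) * (128 * μ * b)                ≡⟨ regroup₃ W μ b ⟩
    256 * μ * (W * W) * b                      ≤⟨ *-monoˡ-≤ b heavy ⟩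
    sum Y * r * b                              ≡⟨ regroup₄ (sum Y) r b ⟩
    r * b * sum Y                              ∎)
    where
    instance
      _ : NonZero (r * b)
      _ = m*n≢0 r b
    regroup₁ : ∀ r b d k m W → r * b * (d * (k * m) + d * W) ≡ r * (k * b * (d * m) + d * b * W)
    regroup₁ = solve-∀
    regroup₂ : ∀ r W → r * (2 * (2 * W) * (2 * W) + 2 * W * W) ≡ 2 * (W * W) * (5 * r)
    regroup₂ = solve-∀
    regroup₃ : ∀ W μ b → 2 * (W * W) * (128 * μ * b) ≡ 256 * μ * (W * W) * b
    regroup₃ = solve-∀
    regroup₄ : ∀ y r b → y * r * b ≡ r * b * y
    regroup₄ = solve-∀

  -- Here `l * m ≤ 2 k m + W`. Multiplying by `b` and using `k b ≤ 2 m`, `b ≤ m` and `m ≤ 2 W` gives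
  -- `l b ≤ 8 W + W`, the source of 18 = 2 · 9. The upper end of the window for `q` is needed
  -- exactly here.
  few : ∀ l q → l * m ≤ k * m + q → q ≤ k * m + W → 2 * μ * l ≤ τ
  few l q lm≤ q≤ = *-cancelʳ-≤ _ _ b (begin
    2 * μ * l * b        ≡⟨ *-assoc (2 * μ) l b ⟩
    2 * μ * (l * b)      ≤⟨ *-monoʳ-≤ (2 * μ) lb≤9W ⟩
    2 * μ * (9 * W)      ≡⟨ regroup μ W ⟩
    18 * μ * W           ≤⟨ <⇒≤ 18μW<τb ⟩
    τ * b                ∎)
    where
    regroup : ∀ μ W → 2 * μ * (9 * W) ≡ 18 * μ * W
    regroup = solve-∀
    regroup₁ : ∀ l b m → l * b * m ≡ l * m * b
    regroup₁ = solve-∀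
    regroup₂ : ∀ k m W b → (k * m + (k * m + W)) * b ≡ 2 * (k * b) * m + W * b
    regroup₂ = solve-∀
    regroup₃ : ∀ W → 2 * (2 * (2 * W)) + W ≡ 9 * W
    regroup₃ = solve-∀
    lb≤9W : l * b ≤ 9 * W
    lb≤9W = *-cancelʳ-≤ _ _ m (begin
      l * b * m                            ≡⟨ regroup₁ l b m ⟩
      l * m * b                            ≤⟨ *-monoˡ-≤ b (≤-trans lm≤ (+-monoʳ-≤ (k * m) q≤)) ⟩
      (k * m + (k * m + W)) * b            ≡⟨ regroup₂ k m W b ⟩
      2 * (k * b) * m + W * b              ≤⟨ +-mono-≤ (*-monoˡ-≤ m (*-monoʳ-≤ 2 (≤-trans kb≤2m (*-monoʳ-≤ 2 m≤2W)))) (*-monoʳ-≤ W b≤m) ⟩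
      2 * (2 * (2 * W)) * m + W * m        ≡⟨ *-distribʳ-+ m (2 * (2 * (2 * W))) W ⟨
      (2 * (2 * (2 * W)) + W) * m          ≡⟨ cong (_* m) (regroup₃ W) ⟩
      9 * W * m                            ∎)

  meet : ∃[ q ] (k * m ≤ q × q ≤ k * m + W × SubsetSums Y (d * q)) → ∃[ s ] (0 < s × SubsetSums (A₁ ++ A₂) s × SubsetSums Y s)
  meet (q , km≤q , q≤ , dq∈Y) with sums q km≤q
  ... | ss , ss⊆B , sum≡dq , length≤ =
    d * q , *-mono-≤ 1≤d (≤-trans (*-mono-≤ 1≤k 1≤m) km≤q) ,
    subst (SubsetSums (A₁ ++ A₂)) sum≡dq (popular-sums 1≤μ ss A₁ A₂ A₁≤μ A₂≤μ
      (All.map (λ s∈B → ≤-trans (few (length ss) q length≤ q≤) (All.lookup popular s∈B)) ss⊆B)) ,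
    dq∈Y

dense-heavy-intersect : ∀ W μ X Y → 1 ≤ W → 1 ≤ μ → 1 ≤ length X → μ ≤ length X →
  All (λ x → 1 ≤ x × x ≤ W) X → All (λ y → 1 ≤ y × y ≤ W) Y → (∀ v → multiplicity v X ≤ μ) →
  512 * μ * W * ⌈log₂ (2 * length X) ⌉ ≤ length X * length X →
  256 * μ * (W * W) ≤ sum Y * length X →
  ∃[ s ] (0 < s × SubsetSums X s × SubsetSums Y s)
dense-heavy-intersect W μ X Y 1≤W 1≤μ 1≤r μ≤r X∈ Y∈ X≤μ dense heavy =
  subst (λ X → ∃[ s ] (0 < s × SubsetSums X s × SubsetSums Y s)) X₁++X₂≡X
    (popular-multiples-intersect W r τ X₁ X₂ Y B 1≤μ 1≤r X₁≤μ X₂≤μ (All.map proj₂ Y∈)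
      (AllPairs.filter⁺ (λ s → τ ≤? f s) (downFrom-descending (suc (2 * W)))) B∈ popular 18μW<τb 5r<128μb heavy)
  where
  open ≤-Reasoning
  r = length X
  Λ = ⌈log₂ (2 * r) ⌉
  h = ⌊ r /2⌋
  h′ = ⌈ r /2⌉
  X₁ = take h X
  X₂ = drop h X
  X₁++X₂≡X = take++drop≡id h X

  h+h′≡r : h + h′ ≡ r
  h+h′≡r = ⌊n/2⌋+⌈n/2⌉≡n r

  ∣X₁∣≡h : length X₁ ≡ h
  ∣X₁∣≡h = trans (length-take h X) (m≤n⇒m⊓n≡m (⌊n/2⌋≤n r))

  ∣X₂∣≡h′ : length X₂ ≡ h′
  ∣X₂∣≡h′ = trans (length-drop h X) (trans (cong (_∸ h) (sym h+h′≡r)) (m+n∸m≡n h h′))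

  -- The logarithm is at least 1 because `2 * r ≥ 2`. This bound also rules out `r = 1`, where one
  -- half would be empty.
  512≤r² : 512 ≤ r * r
  512≤r² = begin
    512 * 1 * 1 * 1   ≤⟨ *-mono-≤ (*-mono-≤ (*-monoʳ-≤ 512 1≤μ) 1≤W) (⌈log₂⌉-mono-≤ (*-monoʳ-≤ 2 1≤r)) ⟩
    512 * μ * W * Λ   ≤⟨ dense ⟩
    r * r             ∎

  1≤h : 1 ≤ h
  1≤h with 2 ≤? r
  ... | yes 2≤r = ⌊n/2⌋-mono 2≤r
  ... | no  2≰r = contradiction (≤-trans 512≤r² (*-mono-≤ (≤-pred (≰⇒> 2≰r)) (≤-pred (≰⇒> 2≰r)))) λ { (s≤s ()) }

  Q = pairSums X₁ X₂
  f : ℕ → ℕ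
  f s = multiplicity s Q

  X₁≤μ : ∀ v → multiplicity v X₁ ≤ μ
  X₁≤μ v = ≤-trans (m≤m+n _ _) (≤-trans (≤-reflexive
    (trans (sym (multiplicity-++ v X₁ X₂)) (cong (multiplicity v) X₁++X₂≡X))) (X≤μ v))

  X₂≤μ : ∀ v → multiplicity v X₂ ≤ μ
  X₂≤μ v = ≤-trans (m≤n+m _ _) (≤-trans (≤-reflexive
    (trans (sym (multiplicity-++ v X₁ X₂)) (cong (multiplicity v) X₁++X₂≡X))) (X≤μ v))

  Q∈ : All (λ s → 1 ≤ s × s ≤ 2 * W) Q
  Q∈ = pairSums-All (All.take⁺ h X∈) (All.drop⁺ h X∈)

  power = ∃-power-of-2 (h * μ) (*-mono-≤ 1≤h 1≤μ)
  J = proj₁ power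

  f<2^J : ∀ s → f s < 2 ^ J
  f<2^J s = ≤-<-trans (≤-trans (pairCount-≤ s X₁ X₂ X₂≤μ) (*-monoˡ-≤ μ (≤-reflexive ∣X₁∣≡h))) (proj₁ (proj₂ power))

  2^J≤2hμ : 2 ^ J ≤ 2 * (h * μ)
  2^J≤2hμ = proj₂ (proj₂ power)

  J≤2Λ : J ≤ 2 * Λ
  J≤2Λ = ≮⇒≥ λ 2Λ<J → <-irrefl refl (begin-strict
    2 ^ J               ≤⟨ 2^J≤2hμ ⟩
    2 * (h * μ)         ≡⟨ double h μ ⟩
    (h + h) * μ         ≤⟨ *-mono-≤ (≤-trans (+-monoʳ-≤ h (⌊n/2⌋≤⌈n/2⌉ r)) (≤-reflexive h+h′≡r)) μ≤r ⟩
    r * r               ≤⟨ *-mono-≤ r≤2^Λ r≤2^Λ ⟩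
    2 ^ Λ * 2 ^ Λ       ≡⟨ ^-distribˡ-+-* 2 Λ Λ ⟨
    2 ^ (Λ + Λ)         ≡⟨ cong (λ n → 2 ^ (Λ + n)) (+-identityʳ Λ) ⟨
    2 ^ (2 * Λ)         <⟨ ^-monoʳ-< 2 (s≤s (s≤s z≤n)) 2Λ<J ⟩
    2 ^ J               ∎)
    where
    double : ∀ h μ → 2 * (h * μ) ≡ (h + h) * μ
    double = solve-∀
    r≤2^Λ : r ≤ 2 ^ Λ
    r≤2^Λ = ≤-trans (m≤m+n r _) (n≤2^⌈log₂n⌉ (2 * r))

  abundant : J * (2304 * (μ * μ * W)) + 2 ^ J * (5 * r) < 128 * μ * length Q
  abundant = subst₂ (λ r q → J * (2304 * (μ * μ * W)) + 2 ^ J * (5 * r) < 128 * μ * q)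
    h+h′≡r (sym (trans (length-pairSums X₁ X₂) (cong₂ _*_ ∣X₁∣≡h ∣X₂∣≡h′)))
    (pairs-abundant h h′ μ W J Λ (2 ^ J) 1≤μ (⌊n/2⌋≤⌈n/2⌉ r) (⌊n/2⌋-mono (n≤1+n (suc r)))
      J≤2Λ 2^J≤2hμ (subst (λ r → 512 * μ * W * Λ ≤ r * r) (sym h+h′≡r) dense)
      (subst (λ r → 512 ≤ r * r) (sym h+h′≡r) 512≤r²))

  -- The parameter 2304 `μ² W` is `128 μ` times `18 μ W`. Dropping one term of the resulting
  -- inequality and cancelling `128 μ`, respectively `τ`, yields the two requirements on `B`.
  level = popular-level Q (suc (2 * W)) J (2304 * (μ * μ * W)) (5 * r) (128 * μ)
            (All.map (λ (_ , s≤2W) → s≤s s≤2W) Q∈) f<2^J abundant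
  τ = 2 ^ proj₁ level
  -- Filtering `downFrom` makes `B` a strictly descending list, so it has no repetitions and its
  -- maximum comes first.
  B = superlevel f τ (downFrom (suc (2 * W)))
  b = length B

  instance
    _ : NonZero μ
    _ = >-nonZero 1≤μ
    _ : NonZero τ
    _ = m^n≢0 2 (proj₁ level)

  18μW<τb : 18 * μ * W < τ * b
  18μW<τb = *-cancelˡ-< (128 * μ) _ _ (begin-strict
    128 * μ * (18 * μ * W)                  ≡⟨ regroup μ W ⟩
    2304 * (μ * μ * W)                      ≤⟨ m≤m+n _ _ ⟩
    2304 * (μ * μ * W) + τ * (5 * r)        <⟨ proj₂ level ⟩
    128 * μ * (τ * b)                       ∎)
    where
    regroup : ∀ μ W → 128 * μ * (18 * μ * W) ≡ 2304 * (μ * μ * W)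
    regroup = solve-∀

  5r<128μb : 5 * r < 128 * μ * b
  5r<128μb = *-cancelˡ-< τ _ _ (begin-strict
    τ * (5 * r)                             ≤⟨ m≤n+m _ _ ⟩
    2304 * (μ * μ * W) + τ * (5 * r)        <⟨ proj₂ level ⟩
    128 * μ * (τ * b)                       ≡⟨ regroup (128 * μ) τ b ⟩
    τ * (128 * μ * b)                       ∎)
    where
    regroup : ∀ x y z → x * (y * z) ≡ y * (x * z)
    regroup = solve-∀

  popular : All (λ s → τ ≤ f s) B
  popular = All.all-filter (λ s → τ ≤? f s) (downFrom (suc (2 * W)))

  -- The value 0 also occurs in `downFrom`. It is excluded because `τ ≥ 1` makes each member of `B`
  -- an actual pair sum.
  B∈ : All (λ s → 1 ≤ s × s ≤ 2 * W) B
  B∈ = All.map (λ {s} τ≤fs → All.lookup Q∈ (multiplicity-≥1⇒∈ s Q (≤-trans (m^n>0 2 (proj₁ level)) τ≤fs))) popular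

open import Data.Integer.Base using (+_)

theorem4 : (W μ : ℕ) → 1 ≤ W → 1 ≤ μ →
    (X Y : Multiset) →
    All (λ x → 1 ≤ x × x ≤ W) X →
    All (λ y → 1 ≤ y × y ≤ W) Y →
    .{{_ : NonZero (length X)}} →
    (∀ v → multiplicity v X ≤ μ) →
    length X ^ 2 ≥ 512 * μ * W * ⌈log₂ (2 * length X) ⌉ →
    (+ sum Y / 1) ≥ℚ (+ (256 * μ * W ^ 2) / length X) →
    ∃[ s ] (0 < s × s ∈ (SubsetSums X ∩ SubsetSums Y))
theorem4 W μ 1≤W 1≤μ X Y X∈ Y∈ X≤μ dense heavy =
  dense-heavy-intersect W μ′ X Y 1≤W (⊓-glb 1≤μ 1≤r) 1≤r (m⊓n≤n μ r) X∈ Y∈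
    (λ v → ⊓-glb (X≤μ v) (length-filter (v ≟_) X))
    (begin
      512 * μ′ * W * ⌈log₂ (2 * r) ⌉   ≤⟨ *-monoˡ-≤ _ (*-monoˡ-≤ W (*-monoʳ-≤ 512 (m⊓n≤m μ r))) ⟩
      512 * μ * W * ⌈log₂ (2 * r) ⌉    ≤⟨ dense ⟩
      r ^ 2                            ≡⟨ cong (r *_) (*-identityʳ r) ⟩
      r * r                            ∎)
    (begin
      256 * μ′ * (W * W)               ≤⟨ *-monoˡ-≤ (W * W) (*-monoʳ-≤ 256 (m⊓n≤m μ r)) ⟩
      256 * μ * (W * W)                ≡⟨ cong (λ n → 256 * μ * (W * n)) (*-identityʳ W) ⟨
      256 * μ * W ^ 2                  ≤⟨ numerators (length X) heavy ⟩
      sum Y * r                        ∎)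
  where
  open ≤-Reasoning
  r = length X
  -- J ≤ 2 ⌈log (2 r)⌉ needs a multiplicity bound of at most r.
  μ′ = μ ⊓ r
  1≤r : 1 ≤ r
  1≤r = >-nonZero⁻¹ r
  -- Generalising `length X` to a variable permits matching on `suc`, after which the unnormalised
  -- fractions compute and the comparison becomes a cross-multiplication in ℤ.
  numerators : ∀ r .{{_ : NonZero r}} {y c} → (+ y / 1) ≥ℚ (+ c / r) → c ≤ y * r
  numerators (suc r) {y} {c} (*≤* c*1≤y*r) = ℤ.drop‿+≤+ (subst₂ ℤ._≤_
    (trans (sym (ℤ.pos-* c 1)) (cong +_ (*-identityʳ c))) (sym (ℤ.pos-* y (suc r))) c*1≤y*r)
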